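{- Let $G$ be a cograph minimal $(\infty,3)$-polar obstruction. Then: (1) $G$ is connected if and only if $\overline{G} \cong P_3 + H$, where $H$ is isomorphic to $K_1 \oplus C_4$, $\overline{2P_3}$, $K_2 \oplus 2K_2$, or $K_1 \oplus (K_2 + P_3)$; (2) $G$ is disconnected and has neither isolated vertices nor components isomorphic to $P_3$ if and only if $G$ is isomorphic to $2C_4$, $2(K_1 \oplus 2K_2)$, or $C_4 + (K_1 \oplus 2K_2)$; (3) $G$ is disconnected and has at least one component isomorphic to $P_3$ if and only if $G \cong P_3 + H$, where $H$ is isomorphic to $P_3 + 2K_2$, $K_2 + (K_1 \oplus 2K_2)$, $K_2 + C_4$, $K_{3,3}$, $2K_1 \oplus (K_2 + 2K_1)$, $K_1 \oplus (K_1 + 2K_2)$, $K_1 \oplus C_4$, $\overline{2P_3}$, $K_2 \oplus 2K_2$, or $K_1 \oplus (K_2 + P_3)$; (4) $G$ has exactly $5$ connected components if and only if $G$ is isomorphic to $4K_1 + (K_1 \oplus C_4)$ or to $pK_1 + (4-p)K_2 + K_{p,p}$ for some $p \in \{1,2,3,4\}$; (5) $G$ has exactly $4$ connected components and at least one isolated vertex if and only if either $G \cong 3K_1 + H$ where $H$ is isomorphic to $\overline{2P_3}$, $K_1 \oplus (P_3 + K_2)$, $K_2 \oplus 2K_2$, $K_1 \oplus (C_4 + K_1)$, $K_1 \oplus \overline{P_3 + K_2}$, or $\overline{K_2} \oplus (P_3 + K_1)$, or $G$ is isomorphic to $pK_1 + (3-p)K_2 + (2K_1 \oplus (K_2 +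 pK_1))$ for some $p \in \{1,2,3\}$; (6) $G$ has exactly $3$ connected components and at least one isolated vertex if and only if either $G \cong 2K_1 + H$ where $H$ is isomorphic to $K_1 \oplus (C_4 + 2K_1)$, $K_1 \oplus 2P_3$, $K_1 \oplus (K_1 + \overline{P_3 + K_2})$, $K_1 \oplus (K_2 + \overline{P_3 + K_1})$, $K_2 \oplus (K_1 + 2K_2)$, $K_1 \oplus (K_1 + K_2 + P_3)$, or $K_1 \oplus (K_1 + (K_1 \oplus 2K_2))$, or $G$ is isomorphic to $pK_1 + (2-p)K_2 + (K_1 \oplus (2K_2 + pK_1))$ for some $p \in \{1,2\}$; (7) $G$ has exactly $2$ connected components and one isolated vertex if and only if $G \cong K_1 + (K_1 \oplus H)$, where $H$ is isomorphic to $P_3 + C_4$, $P_3 + (K_1 \oplus 2K_2)$, $2P_3 + K_2$, $K_1 + 3K_2$, $2K_1 + K_2 + C_4$, $3K_1 + K_{3,3}$, $K_1 + K_2 + (2K_1 \oplus (K_2 + K_1))$, $2K_1 + (2K_1 \oplus (K_2 + 2K_1))$, or $K_1 + (K_1 \oplus (K_1 + 2K_2))$. In conclusion, a graph $G$ is a cograph minimal $(\infty,3)$-polar obstruction if and only if it is isomorphic to one of the $49$ cographs listed above.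
   Context: All graphs are finite and simple. A cograph is a graph with no induced subgraph isomorphic to $P_4$. $G+H$ denotes disjoint union, $G \oplus H$ the join (disjoint union plus all edges between $G$ and $H$), $nG$ the disjoint union of $n$ copies of $G$ ($0G$ is the empty graph), $\overline{G}$ the complement of $G$; $K_n$, $P_n$, $C_n$ are the complete graph, path and cycle on $n$ vertices and $K_{p,q}$ the complete bipartite graph. A cluster is a disjoint union of complete graphs. For $s,k \in \mathbb{Z}_{\ge 0}\cup\{\infty\}$, an $(s,k)$-polar partition of $G$ is a partition $(A,B)$ of $V(G)$ (parts may be empty) such that $G[A]$ is a complete multipartite graph with at most $s$ parts and $G[B]$ is a cluster with at most $k$ components; $\infty$ means unbounded. $G$ is $(s,k)$-polar if it has such a partition. A cograph minimal $(s,k)$-polar obstruction is a cograph that is not $(s,k)$-polar but all of whose proper induced subgraphs are $(s,k)$-polar. -}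

module Defs where

open import Data.Bool using (Bool; true; false; not; _∧_; _∨_)
open import Data.Bool.Properties using (∨-comm)
open import Data.Nat using (ℕ; zero; suc; _+_; _≡ᵇ_)
open import Data.Fin using (Fin; toℕ; splitAt; _≟_)
open import Data.Sum using (_⊎_; inj₁; inj₂)
open import Data.Product using (Σ; Σ-syntax; ∃; ∃-syntax; _×_; _,_)
open import Data.List using (List; []; _∷_; map; _++_)
open import Data.Empty using (⊥-elim)
open import Relation.Nullary using (¬_; does; yes; no)
open import Relation.Binary.PropositionalEquality using (_≡_; _≢_; refl; sym; cong; cong₂)
open import Function.Definitions using (Injective; Surjective)
open import Function.Bundles using (_⇔_)

record Graph : Set where
  field
    n     : ℕ
    adj   : Fin n → Fin n → Bool
    adj-sym : ∀ u v → adj u v ≡ adj v u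
    adj-irr : ∀ v → adj v v ≡ false
open Graph public

V : Graph → Set
V G = Fin (n G)

private
  does-sym : ∀ {m} (u v : Fin m) → does (u ≟ v) ≡ does (v ≟ u)
  does-sym u v with u ≟ v | v ≟ u
  ... | yes _ | yes _ = refl
  ... | no _  | no _  = refl
  ... | yes p | no q  = ⊥-elim (q (sym p))
  ... | no p  | yes q = ⊥-elim (p (sym q))

mkGraph : (m : ℕ) → (Fin m → Fin m → Bool) → Graph
mkGraph m r = record
  { n = m
  ; adj = λ u v → not (does (u ≟ v)) ∧ (r u v ∨ r v u)
  ; adj-sym = λ u v → cong₂ _∧_ (cong not (does-sym u v)) (∨-comm (r u v) (r v u))
  ; adj-irr = irr
  }
  where
  irr : ∀ v → not (does (v ≟ v)) ∧ (r v v ∨ r v v) ≡ false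
  irr v with v ≟ v
  ... | yes _ = refl
  ... | no ¬p = ⊥-elim (¬p refl)

edgeless : ℕ → Graph
edgeless m = mkGraph m (λ _ _ → false)

K : ℕ → Graph
K m = mkGraph m (λ _ _ → true)

P : ℕ → Graph
P m = mkGraph m (λ u v → suc (toℕ u) ≡ᵇ toℕ v)

-- cycle C_m (meant for m ≥ 3; only C 4 is used): path plus edge {0, m-1}
C : ℕ → Graph
C m = mkGraph m (λ u v → (suc (toℕ u) ≡ᵇ toℕ v) ∨ ((toℕ u ≡ᵇ 0) ∧ (suc (toℕ v) ≡ᵇ m)))

complement : Graph → Graph
complement G = mkGraph (n G) (λ u v → not (adj G u v))

private
  sumAdj : ∀ {A B : Set} → Bool → (A → A → Bool) → (B → B → Bool) → A ⊎ B → A ⊎ B → Bool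
  sumAdj c f g (inj₁ a) (inj₁ a') = f a a'
  sumAdj c f g (inj₂ b) (inj₂ b') = g b b'
  sumAdj c f g _ _ = c

  combine : Bool → Graph → Graph → Graph
  combine c G H = mkGraph (n G + n H)
    (λ u v → sumAdj c (adj G) (adj H) (splitAt (n G) u) (splitAt (n G) v))

infixr 5 _∔_ _⊕_
infixr 7 _∙_

_∔_ : Graph → Graph → Graph
G ∔ H = combine false G H

_⊕_ : Graph → Graph → Graph
G ⊕ H = combine true G H

_∙_ : ℕ → Graph → Graph
zero ∙ G = edgeless 0
suc k ∙ G = G ∔ (k ∙ G)

Kb : ℕ → ℕ → Graph
Kb p q = edgeless p ⊕ edgeless q

record _≅_ (G H : Graph) : Set where
  field
    to      : V G → V H
    from    : V H → V G
    from-to : ∀ u → from (to u) ≡ u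
    to-from : ∀ v → to (from v) ≡ v
    preserves : ∀ u v → adj H (to u) (to v) ≡ adj G u v

induce : (G : Graph) {m : ℕ} → (Fin m → V G) → Graph
induce G {m} f = mkGraph m (λ i j → adj G (f i) (f j))

Cograph : Graph → Set
Cograph G = ∀ (f : Fin 4 → V G) → Injective _≡_ _≡_ f → ¬ (induce G f ≅ P 4)

data Bound : Set where
  fin : ℕ → Bound
  ∞   : Bound

-- labels for at most s parts / at most k components
Labels : Bound → Set
Labels (fin m) = Fin m
Labels ∞ = ℕ

-- A partition (A,B) is given by side : V → Bool (true = A, false = B).
-- G[A] is complete multipartite with ≤ s parts: a labelling p of A by
-- ≤ s labels, with distinct vertices of A adjacent iff labels differ.
-- G[B] is a cluster with ≤ k components: a labelling q of B by ≤ k labels,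
-- with distinct vertices of B adjacent iff labels coincide.
Polar : Bound → Bound → Graph → Set
Polar s k G =
  Σ[ side ∈ (V G → Bool) ] Σ[ p ∈ (V G → Labels s) ] Σ[ q ∈ (V G → Labels k) ]
    (∀ u v → u ≢ v →
       (side u ≡ true → side v ≡ true → (adj G u v ≡ true ⇔ p u ≢ p v)) ×
       (side u ≡ false → side v ≡ false → (adj G u v ≡ true ⇔ q u ≡ q v)))

CographMinObs : Bound → Bound → Graph → Set
CographMinObs s k G =
  Cograph G × ¬ Polar s k G ×
  (∀ {m} (f : Fin m → V G) → Injective _≡_ _≡_ f → suc m Data.Nat.≤ n G →
     Polar s k (induce G f))

data Reach (G : Graph) : V G → V G → Set where
  here : ∀ {u} → Reach G u u
  step : ∀ {u w v} → adj G u w ≡ true → Reach G w v → Reach G u v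

NumComponents : Graph → ℕ → Set
NumComponents G c =
  Σ[ f ∈ (V G → Fin c) ] Surjective _≡_ _≡_ f × (∀ u v → (f u ≡ f v ⇔ Reach G u v))

Connected : Graph → Set
Connected G = NumComponents G 1

HasIsolated : Graph → Set
HasIsolated G = ∃[ v ] (∀ u → adj G v u ≡ false)

-- G has a connected component isomorphic to the (connected) graph H:
-- an injective f : V H → V G whose image is closed under reachability
-- and induces a copy of H.
HasComponentIso : Graph → Graph → Set
HasComponentIso G H =
  Σ[ f ∈ (V H → V G) ] Injective _≡_ _≡_ f ×
    (∀ i v → Reach G (f i) v → ∃[ j ] f j ≡ v) × (induce G f ≅ H)

K1 K2 P3 C4 : Graph
K1 = K 1
K2 = K 2
P3 = P 3
C4 = C 4

-- (1): H with complement G ≅ P3 + H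
list1 : List Graph
list1 = (K1 ⊕ C4) ∷ complement (2 ∙ P3) ∷ (K2 ⊕ (2 ∙ K2)) ∷ (K1 ⊕ (K2 ∔ P3)) ∷ []

list2 : List Graph
list2 = (2 ∙ C4) ∷ (2 ∙ (K1 ⊕ (2 ∙ K2))) ∷ (C4 ∔ (K1 ⊕ (2 ∙ K2))) ∷ []

-- (3): H with G ≅ P3 + H
list3 : List Graph
list3 = (P3 ∔ (2 ∙ K2)) ∷ (K2 ∔ (K1 ⊕ (2 ∙ K2))) ∷ (K2 ∔ C4) ∷ Kb 3 3
      ∷ ((2 ∙ K1) ⊕ (K2 ∔ (2 ∙ K1))) ∷ (K1 ⊕ (K1 ∔ (2 ∙ K2))) ∷ (K1 ⊕ C4)
      ∷ complement (2 ∙ P3) ∷ (K2 ⊕ (2 ∙ K2)) ∷ (K1 ⊕ (K2 ∔ P3)) ∷ []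

fam4 : ℕ → Graph
fam4 p = ((p ∙ K1) ∔ ((4 Data.Nat.∸ p) ∙ K2)) ∔ Kb p p

-- (5): H with G ≅ 3K1 + H, and the p-family
list5 : List Graph
list5 = complement (2 ∙ P3) ∷ (K1 ⊕ (P3 ∔ K2)) ∷ (K2 ⊕ (2 ∙ K2)) ∷ (K1 ⊕ (C4 ∔ K1))
      ∷ (K1 ⊕ complement (P3 ∔ K2)) ∷ (complement K2 ⊕ (P3 ∔ K1)) ∷ []

fam5 : ℕ → Graph
fam5 p = ((p ∙ K1) ∔ ((3 Data.Nat.∸ p) ∙ K2)) ∔ ((2 ∙ K1) ⊕ (K2 ∔ (p ∙ K1)))

-- (6): H with G ≅ 2K1 + H, and the p-family
list6 : List Graph
list6 = (K1 ⊕ (C4 ∔ (2 ∙ K1))) ∷ (K1 ⊕ (2 ∙ P3)) ∷ (K1 ⊕ (K1 ∔ complement (P3 ∔ K2)))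
      ∷ (K1 ⊕ (K2 ∔ complement (P3 ∔ K1))) ∷ (K2 ⊕ (K1 ∔ (2 ∙ K2)))
      ∷ (K1 ⊕ (K1 ∔ (K2 ∔ P3))) ∷ (K1 ⊕ (K1 ∔ (K1 ⊕ (2 ∙ K2)))) ∷ []

fam6 : ℕ → Graph
fam6 p = ((p ∙ K1) ∔ ((2 Data.Nat.∸ p) ∙ K2)) ∔ (K1 ⊕ ((2 ∙ K2) ∔ (p ∙ K1)))

-- (7): H with G ≅ K1 + (K1 ⊕ H)
list7 : List Graph
list7 = (P3 ∔ C4) ∷ (P3 ∔ (K1 ⊕ (2 ∙ K2))) ∷ ((2 ∙ P3) ∔ K2) ∷ (K1 ∔ (3 ∙ K2))
      ∷ ((2 ∙ K1) ∔ (K2 ∔ C4)) ∷ ((3 ∙ K1) ∔ Kb 3 3)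
      ∷ (K1 ∔ (K2 ∔ ((2 ∙ K1) ⊕ (K2 ∔ K1))))
      ∷ ((2 ∙ K1) ∔ ((2 ∙ K1) ⊕ (K2 ∔ (2 ∙ K1))))
      ∷ (K1 ∔ (K1 ⊕ (K1 ∔ (2 ∙ K2)))) ∷ []

all49 : List Graph
all49 =
     map (λ H → complement (P3 ∔ H)) list1
  ++ list2
  ++ map (λ H → P3 ∔ H) list3
  ++ ((4 ∙ K1) ∔ (K1 ⊕ C4)) ∷ fam4 1 ∷ fam4 2 ∷ fam4 3 ∷ fam4 4 ∷ []
  ++ map (λ H → (3 ∙ K1) ∔ H) list5
  ++ fam5 1 ∷ fam5 2 ∷ fam5 3 ∷ []
  ++ map (λ H → (2 ∙ K1) ∔ H) list6
  ++ fam6 1 ∷ fam6 2 ∷ []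
  ++ map (λ H → K1 ∔ (K1 ⊕ H)) list7

{-# OPTIONS --safe #-}
module Submission where

-- A P₄-free graph is built from single vertices by disjoint unions and joins, so it has a
-- cotree.  Along a cotree, three numbers suffice to decide (∞,3)-polarity: the least number
-- of clusters in a polar partition (A, B) with A empty, with A independent, and with A
-- arbitrary, each truncated at 4.  These profiles compose under union and join, and there
-- is a finite list of polar cotrees, minimal for their profile, such that the union or join
-- of any two of them can be cut down, keeping its profile, to a member of the list or to one
-- of the 49 obstructions.  Hence every nonpolar cograph contains one of the 49, and a
-- minimal one is isomorphic to it.

open import Defs
open import Data.Bool using (Bool; true; false; not; _∧_; _∨_; if_then_else_; T)
import Data.Bool as Bool
open import Data.Bool.Properties using (not-involutive; not-injective; not-¬; ¬-not; ∨-idem; ∧-zeroʳ; T-∧; T-∨; T-≡)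
open import Data.Bool.ListAction using (all)
open import Data.Nat using (ℕ; zero; suc; _+_; _⊓_; _≡ᵇ_; _<ᵇ_; _≤_; _<_; z≤n; s≤s)
open import Data.Nat.Properties using (≤-trans; ≤-refl; ≤-pred; ≤-<-trans; <-irrefl; m≤m+n; m≤n+m; ⊓-sel; m⊓n≤m; m⊓n≤n; +-identityʳ; +-mono-≤; m+n≡0⇒m≡0; m+n≡0⇒n≡0; +-monoʳ-<; <⇒≱; +-cancelˡ-≡; _<?_; _≤?_; _≟_; ≡ᵇ⇒≡; <ᵇ⇒<; <⇒<ᵇ; ≤⇒≯; ≰⇒>; ≤-antisym)
open import Data.Fin using (Fin; zero; suc; splitAt; join; fromℕ<)
open import Data.Fin.Properties using (suc-injective; join-splitAt; splitAt-join; fromℕ<-cong; fromℕ<-injective; injective⇒≤; any?; all?; ¬∀⟶∃¬)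
import Data.Fin as Fin
open import Data.Unit using (⊤; tt)
open import Data.Empty using (⊥; ⊥-elim)
open import Data.List as List using (List; []; _∷_; _++_)
open import Data.List.Membership.Propositional using (_∈_; find; lose)
open import Data.List.Relation.Unary.Any as Any using (Any; here; there)
open import Data.List.Relation.Unary.Any.Properties using (map⁺; map⁻; ++⁺ˡ; ++⁺ʳ; ++⁻; applyUpTo⁺; applyUpTo⁻)
open import Data.List.Membership.Propositional.Properties using (∈-map⁺; ∈-map⁻; ∈-filter⁺; ∈-filter⁻)
import Data.List.Relation.Unary.All as All
open import Data.List.Relation.Unary.All.Properties using (all⁺)
open import Data.Maybe using (Maybe; just; nothing)
open import Data.Product using (Σ-syntax; ∃; ∃-syntax; _×_; _,_; proj₁; proj₂)
open import Data.Product.Function.NonDependent.Propositional using (_×-⇔_)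
open import Data.Sum as Sum using (_⊎_; inj₁; inj₂; swap; assocˡ; assocʳ; [_,_])
open import Data.Sum.Properties using (swap-involutive; ≡-dec; inj₁-injective; inj₂-injective)
open import Function using (id; _∘_; case_of_)
open import Function.Bundles using (_⇔_; mk⇔; Equivalence)
open import Function.Construct.Composition using () renaming (equivalence to infixr 9 _⇔⨟_)
open import Function.Definitions using (Injective; Surjective)
open import Function.Related.TypeIsomorphisms using (¬-cong-⇔)
open import Relation.Nullary using (¬_; Dec; does; yes; no; contradiction)
open import Relation.Nullary.Decidable as Dec using (decidable-stable; toWitness; _→-dec_; _×-dec_; _⊎-dec_; ¬?)
open import Relation.Binary.PropositionalEquality using (_≡_; _≢_; refl; sym; trans; cong; cong₂; subst; subst₂)

-- Three numbers suffice because of how a complete multipartite set `A` can cross a node. In a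
-- union, `A` either lies on one side or is independent, and then it is independent on both. In a
-- join, `A` may be arbitrary on both sides, since the number of its parts is unbounded, but an
-- independent `A` lies on one side. Dually, the cluster part splits freely over a union, while
-- across a join it is absent from one side or is a clique on both. Only whether the last number is
-- at most 3 matters in the end, hence the truncation at 4.
--
-- What remains is settled by evaluation. The list of polar cotrees is a certificate: its closure,
-- the minimality of the 49 and the validity of every item for each of them are computable tests on
-- closed cotrees. For such tests to compare graphs by syntactic equality, cotrees are sorted into a
-- normal form; for them to speak about the graphs of the statement, every listed graph is carried
-- together with a cotree of it.

-- Structures, induced embeddings and cotrees

-- Carriers are arbitrary types, so that the leaves of a cotree can form a nested sum and most
-- arguments are free of index arithmetic in `Fin`.
record Structure : Set₁ where
  constructor _,,_
  field
    Carrier : Set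
    _~_     : Carrier → Carrier → Bool
open Structure using (Carrier)

rel : (X : Structure) → Carrier X → Carrier X → Bool
rel = Structure._~_

⟨_⟩ : Graph → Structure
⟨ G ⟩ = V G ,, adj G

infix 4 _↪_ _≃_

record _↪_ (X Y : Structure) : Set where
  field
    map   : Carrier X → Carrier Y
    inj   : ∀ {u v} → map u ≡ map v → u ≡ v
    pres  : ∀ u v → rel Y (map u) (map v) ≡ rel X u v

record _≃_ (X Y : Structure) : Set where
  field
    to      : Carrier X → Carrier Y
    from    : Carrier Y → Carrier X
    from-to : ∀ u → from (to u) ≡ u
    to-from : ∀ v → to (from v) ≡ v
    pres    : ∀ u v → rel Y (to u) (to v) ≡ rel X u v

module _ {X Y : Structure} where

  ≃⇒↪ : X ≃ Y → X ↪ Y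
  ≃⇒↪ e = record
    { map  = to
    ; inj  = λ {u} {v} p → trans (sym (from-to u)) (trans (cong from p) (from-to v))
    ; pres = pres }
    where open _≃_ e

  ≃-sym : X ≃ Y → Y ≃ X
  ≃-sym e = record
    { to = from ; from = to ; from-to = to-from ; to-from = from-to
    ; pres = λ u v → trans (sym (pres (from u) (from v))) (cong₂ (rel Y) (to-from u) (to-from v)) }
    where open _≃_ e

↪-refl : ∀ {X} → X ↪ X
↪-refl = record { map = id ; inj = id ; pres = λ _ _ → refl }

↪-trans : ∀ {X Y Z} → X ↪ Y → Y ↪ Z → X ↪ Z
↪-trans f g = record
  { map  = G.map ∘ F.map
  ; inj  = F.inj ∘ G.inj
  ; pres = λ u v → trans (G.pres _ _) (F.pres u v) }
  where
  module F = _↪_ f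
  module G = _↪_ g

≃-refl : ∀ {X} → X ≃ X
≃-refl = record
  { to = id ; from = id ; from-to = λ _ → refl ; to-from = λ _ → refl ; pres = λ _ _ → refl }

≃-trans : ∀ {X Y Z} → X ≃ Y → Y ≃ Z → X ≃ Z
≃-trans f g = record
  { to      = G.to ∘ F.to
  ; from    = F.from ∘ G.from
  ; from-to = λ u → trans (cong F.from (G.from-to _)) (F.from-to u)
  ; to-from = λ v → trans (cong G.to (F.to-from _)) (G.to-from v)
  ; pres    = λ u v → trans (G.pres _ _) (F.pres u v) }
  where
  module F = _≃_ f
  module G = _≃_ g

≅⇒≃ : ∀ {G H} → G ≅ H → ⟨ G ⟩ ≃ ⟨ H ⟩
≅⇒≃ e = record { to = to ; from = from ; from-to = from-to ; to-from = to-from ; pres = preserves }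
  where open _≅_ e

≃⇒≅ : ∀ {G H} → ⟨ G ⟩ ≃ ⟨ H ⟩ → G ≅ H
≃⇒≅ e = record { to = to ; from = from ; from-to = from-to ; to-from = to-from ; preserves = pres }
  where open _≃_ e

𝟙 : Structure
𝟙 = ⊤ ,, λ _ _ → false

Node : Bool → Structure → Structure → Structure
Node c X Y = (Carrier X ⊎ Carrier Y) ,, λ where
  (inj₁ u) (inj₁ v) → rel X u v
  (inj₂ u) (inj₂ v) → rel Y u v
  (inj₁ _) (inj₂ _) → c
  (inj₂ _) (inj₁ _) → c

module _ {c : Bool} {X Y : Structure} where

  left : X ↪ Node c X Y
  left = record { map = inj₁ ; inj = λ { refl → refl } ; pres = λ _ _ → refl }

  right : Y ↪ Node c X Y
  right = record { map = inj₂ ; inj = λ { refl → refl } ; pres = λ _ _ → refl }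

  swap≃ : Node c X Y ≃ Node c Y X
  swap≃ = record
    { to = swap ; from = swap ; from-to = swap-involutive ; to-from = swap-involutive
    ; pres = λ { (inj₁ _) (inj₁ _) → refl ; (inj₁ _) (inj₂ _) → refl
               ; (inj₂ _) (inj₁ _) → refl ; (inj₂ _) (inj₂ _) → refl } }

  assoc≃ : ∀ {Z} → Node c (Node c X Y) Z ≃ Node c X (Node c Y Z)
  assoc≃ = record
    { to = assocʳ ; from = assocˡ
    ; from-to = λ { (inj₁ (inj₁ _)) → refl ; (inj₁ (inj₂ _)) → refl ; (inj₂ _) → refl }
    ; to-from = λ { (inj₁ _) → refl ; (inj₂ (inj₁ _)) → refl ; (inj₂ (inj₂ _)) → refl }
    ; pres = λ { (inj₁ (inj₁ _)) (inj₁ (inj₁ _)) → refl ; (inj₁ (inj₁ _)) (inj₁ (inj₂ _)) → refl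
               ; (inj₁ (inj₁ _)) (inj₂ _) → refl
               ; (inj₁ (inj₂ _)) (inj₁ (inj₁ _)) → refl ; (inj₁ (inj₂ _)) (inj₁ (inj₂ _)) → refl
               ; (inj₁ (inj₂ _)) (inj₂ _) → refl
               ; (inj₂ _) (inj₁ (inj₁ _)) → refl ; (inj₂ _) (inj₁ (inj₂ _)) → refl
               ; (inj₂ _) (inj₂ _) → refl } }

module _ {c : Bool} {X X′ Y Y′ : Structure} where

  Node-↪ : X ↪ X′ → Y ↪ Y′ → Node c X Y ↪ Node c X′ Y′
  Node-↪ f g = record
    { map  = Sum.map F.map G.map
    ; inj  = λ { {inj₁ _} {inj₁ _} p → cong inj₁ (F.inj (inj₁-injective p))
               ; {inj₂ _} {inj₂ _} p → cong inj₂ (G.inj (inj₂-injective p)) }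
    ; pres = λ { (inj₁ u) (inj₁ v) → F.pres u v ; (inj₁ _) (inj₂ _) → refl
               ; (inj₂ _) (inj₁ _) → refl ; (inj₂ u) (inj₂ v) → G.pres u v } }
    where
    module F = _↪_ f
    module G = _↪_ g

  Node-≃ : X ≃ X′ → Y ≃ Y′ → Node c X Y ≃ Node c X′ Y′
  Node-≃ f g = record
    { to      = Sum.map F.to G.to
    ; from    = Sum.map F.from G.from
    ; from-to = λ { (inj₁ u) → cong inj₁ (F.from-to u) ; (inj₂ u) → cong inj₂ (G.from-to u) }
    ; to-from = λ { (inj₁ u) → cong inj₁ (F.to-from u) ; (inj₂ u) → cong inj₂ (G.to-from u) }
    ; pres = λ { (inj₁ u) (inj₁ v) → F.pres u v ; (inj₁ _) (inj₂ _) → refl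
               ; (inj₂ _) (inj₁ _) → refl ; (inj₂ u) (inj₂ v) → G.pres u v } }
    where
    module F = _≃_ f
    module G = _≃_ g

-- The label is the adjacency across the node, so one constructor serves for union and join, and
-- arguments invariant under complementation are given once for both values. There is no empty
-- cotree: every subtree has a leaf (`root`), which is what makes a join connected.
data Cotree : Set where
  •    : Cotree
  node : Bool → Cotree → Cotree → Cotree

infixr 5 _∪_
infixr 6 _⋈_
pattern _∪_ s t = node false s t
pattern _⋈_ s t = node true s t

⟪_⟫ : Cotree → Structure
⟪ • ⟫          = 𝟙
⟪ node c s t ⟫ = Node c ⟪ s ⟫ ⟪ t ⟫

Leaf : Cotree → Set
Leaf t = Carrier ⟪ t ⟫

adjᵗ : (t : Cotree) → Leaf t → Leaf t → Bool
adjᵗ t = rel ⟪ t ⟫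

adjᵗ-sym : ∀ t u v → adjᵗ t u v ≡ adjᵗ t v u
adjᵗ-sym • _ _ = refl
adjᵗ-sym (node c s t) (inj₁ u) (inj₁ v) = adjᵗ-sym s u v
adjᵗ-sym (node c s t) (inj₁ u) (inj₂ v) = refl
adjᵗ-sym (node c s t) (inj₂ u) (inj₁ v) = refl
adjᵗ-sym (node c s t) (inj₂ u) (inj₂ v) = adjᵗ-sym t u v

-- Cographs and cotrees

-- Distinctness of the four vertices is implied in a graph: no two vertices of a P₄ have the same
-- neighbourhood (`P4-rows`).
record InducedP4 (X : Structure) : Set where
  constructor path
  field
    {a b c d} : Carrier X
    ab : rel X a b ≡ true
    bc : rel X b c ≡ true
    cd : rel X c d ≡ true
    ac : rel X a c ≡ false
    ad : rel X a d ≡ false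
    bd : rel X b d ≡ false

InducedP4-↪ : ∀ {X Y} → X ↪ Y → InducedP4 X → InducedP4 Y
InducedP4-↪ f (path ab bc cd ac ad bd) =
  path (trans (pres _ _) ab) (trans (pres _ _) bc) (trans (pres _ _) cd)
       (trans (pres _ _) ac) (trans (pres _ _) ad) (trans (pres _ _) bd)
  where open _↪_ f

-- P₄ and its complement are both connected. If the path meets both sides of a union, one of its
-- edges `ab`, `bc`, `cd` crosses; if it meets both sides of a join, one of its nonedges `ac`, `ad`,
-- `bd` crosses.
cotree-P4-free : ∀ t → ¬ InducedP4 ⟪ t ⟫
cotree-P4-free • (path () _ _ _ _ _)
cotree-P4-free (node c s t) (path {inj₁ _} {inj₁ _} {inj₁ _} {inj₁ _} ab bc cd ac ad bd) =
  cotree-P4-free s (path ab bc cd ac ad bd)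
cotree-P4-free (node c s t) (path {inj₂ _} {inj₂ _} {inj₂ _} {inj₂ _} ab bc cd ac ad bd) =
  cotree-P4-free t (path ab bc cd ac ad bd)
cotree-P4-free (s ∪ t) (path {inj₁ _} {inj₂ _} () _ _ _ _ _)
cotree-P4-free (s ∪ t) (path {inj₂ _} {inj₁ _} () _ _ _ _ _)
cotree-P4-free (s ∪ t) (path {_} {inj₁ _} {inj₂ _} _ () _ _ _ _)
cotree-P4-free (s ∪ t) (path {_} {inj₂ _} {inj₁ _} _ () _ _ _ _)
cotree-P4-free (s ∪ t) (path {_} {_} {inj₁ _} {inj₂ _} _ _ () _ _ _)
cotree-P4-free (s ∪ t) (path {_} {_} {inj₂ _} {inj₁ _} _ _ () _ _ _)
cotree-P4-free (s ⋈ t) (path {inj₁ _} {_} {inj₂ _} _ _ _ () _ _)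
cotree-P4-free (s ⋈ t) (path {inj₂ _} {_} {inj₁ _} _ _ _ () _ _)
cotree-P4-free (s ⋈ t) (path {inj₁ _} {_} {_} {inj₂ _} _ _ _ _ () _)
cotree-P4-free (s ⋈ t) (path {inj₂ _} {_} {_} {inj₁ _} _ _ _ _ () _)
cotree-P4-free (s ⋈ t) (path {_} {inj₁ _} {_} {inj₂ _} _ _ _ _ _ ())
cotree-P4-free (s ⋈ t) (path {_} {inj₂ _} {_} {inj₁ _} _ _ _ _ _ ())

-- One new vertex with neighbourhood `N`: cotrees of graphs are built by adding vertices one at a
-- time.
Extend : (X : Structure) → (Carrier X → Bool) → Structure
Extend X N = (⊤ ⊎ Carrier X) ,, λ where
  (inj₁ _) (inj₁ _) → false
  (inj₁ _) (inj₂ v) → N v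
  (inj₂ u) (inj₁ _) → N u
  (inj₂ u) (inj₂ v) → rel X u v

Extend-const : ∀ {X N b} → (∀ u → N u ≡ b) → Node b 𝟙 X ≃ Extend X N
Extend-const N≡b = record
  { to = id ; from = id ; from-to = λ _ → refl ; to-from = λ _ → refl
  ; pres = λ { (inj₁ _) (inj₁ _) → refl ; (inj₁ _) (inj₂ v) → N≡b v
             ; (inj₂ u) (inj₁ _) → N≡b u ; (inj₂ _) (inj₂ _) → refl } }

Extend-≃ : ∀ {X Y N} (e : X ≃ Y) → Extend X (N ∘ _≃_.to e) ≃ Extend Y N
Extend-≃ e = record
  { to = Sum.map₂ to ; from = Sum.map₂ from
  ; from-to = λ { (inj₁ _) → refl ; (inj₂ u) → cong inj₂ (from-to u) }
  ; to-from = λ { (inj₁ _) → refl ; (inj₂ u) → cong inj₂ (to-from u) }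
  ; pres = λ { (inj₁ _) (inj₁ _) → refl ; (inj₁ _) (inj₂ v) → refl
             ; (inj₂ u) (inj₁ _) → refl ; (inj₂ u) (inj₂ v) → pres u v } }
  where open _≃_ e

-- A new vertex that sees one side exactly as the root label prescribes can be added inside the
-- other side; this is the recursive step of `extend`.
Extend-left : ∀ {c X Y N} → (∀ v → N (inj₂ v) ≡ c) →
  Node c (Extend X (N ∘ inj₁)) Y ≃ Extend (Node c X Y) N
Extend-left N≡c = record
  { to = assocʳ ; from = assocˡ
  ; from-to = λ { (inj₁ (inj₁ _)) → refl ; (inj₁ (inj₂ _)) → refl ; (inj₂ _) → refl }
  ; to-from = λ { (inj₁ _) → refl ; (inj₂ (inj₁ _)) → refl ; (inj₂ (inj₂ _)) → refl }
  ; pres = λ { (inj₁ (inj₁ _)) (inj₁ (inj₁ _)) → refl ; (inj₁ (inj₁ _)) (inj₁ (inj₂ _)) → refl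
             ; (inj₁ (inj₁ _)) (inj₂ v) → N≡c v
             ; (inj₁ (inj₂ _)) (inj₁ (inj₁ _)) → refl ; (inj₁ (inj₂ _)) (inj₁ (inj₂ _)) → refl
             ; (inj₁ (inj₂ _)) (inj₂ _) → refl
             ; (inj₂ u) (inj₁ (inj₁ _)) → N≡c u ; (inj₂ _) (inj₁ (inj₂ _)) → refl
             ; (inj₂ _) (inj₂ _) → refl } }

Extend-right : ∀ {c X Y N} → (∀ u → N (inj₁ u) ≡ c) →
  Node c X (Extend Y (N ∘ inj₂)) ≃ Extend (Node c X Y) N
Extend-right {c} {X} {Y} {N} N≡c =
  ≃-trans swap≃ (≃-trans (Extend-left {N = N ∘ swap} N≡c) (Extend-≃ {N = N} swap≃))

everywhere? : ∀ t (N : Leaf t → Bool) b → (∀ u → N u ≡ b) ⊎ (∃[ u ] N u ≡ not b)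
everywhere? • N b with N tt in eq | b
... | true  | true  = inj₁ λ _ → eq
... | true  | false = inj₂ (tt , eq)
... | false | true  = inj₂ (tt , eq)
... | false | false = inj₁ λ _ → eq
everywhere? (node c s t) N b with everywhere? s (N ∘ inj₁) b | everywhere? t (N ∘ inj₂) b
... | inj₂ (u , p) | _            = inj₂ (inj₁ u , p)
... | inj₁ _       | inj₂ (u , p) = inj₂ (inj₂ u , p)
... | inj₁ p       | inj₁ q       = inj₁ [ p , q ]

root : ∀ t → Leaf t
root •            = tt
root (node c s t) = inj₁ (root s)

bool-cases : ∀ b c → b ≡ c ⊎ b ≡ not c
bool-cases true  true  = inj₁ refl
bool-cases true  false = inj₂ refl
bool-cases false true  = inj₂ refl
bool-cases false false = inj₁ refl

record Mixed (c : Bool) (t : Cotree) (N : Leaf t → Bool) : Set where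
  constructor mixed
  field
    {u w} : Leaf t
    u~w   : adjᵗ t u w ≡ not c
    Nu    : N u ≡ not c
    Nw    : N w ≡ c

record Separated (c : Bool) (t : Cotree) (N : Leaf t → Bool) : Set where
  constructor separated
  field
    s₁ s₂ : Cotree
    iso     : ⟪ node c s₁ s₂ ⟫ ≃ ⟪ t ⟫
    N₁      : ∀ u → N (_≃_.to iso (inj₁ u)) ≡ not c
    N₂      : ∀ u → N (_≃_.to iso (inj₂ u)) ≡ c

-- For c = false: either some edge leaves N, or N is a union of components of t.
separate : ∀ c t N → Mixed c t N ⊎ (∃[ b ] ∀ u → N u ≡ b) ⊎ Separated c t N
separate c • N = inj₂ (inj₁ (N tt , λ _ → refl))
separate c (node d s t) N with bool-cases d c
... | inj₁ refl = glue (separate c s (N ∘ inj₁)) (separate c t (N ∘ inj₂))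
  where
  shuffle : ∀ {A B X Y} → Node c (Node c A X) (Node c B Y) ≃ Node c (Node c A B) (Node c X Y)
  shuffle = ≃-trans assoc≃ (≃-trans (Node-≃ ≃-refl (≃-trans (≃-sym assoc≃)
              (≃-trans (Node-≃ swap≃ ≃-refl) assoc≃))) (≃-sym assoc≃))
  glue : _ → _ → _
  glue (inj₁ (mixed e p q)) _ = inj₁ (mixed e p q)
  glue _ (inj₁ (mixed e p q)) = inj₁ (mixed e p q)
  glue (inj₂ (inj₁ (b , p))) (inj₂ (inj₁ (b′ , q))) with bool-cases b c | bool-cases b′ c
  ... | inj₁ refl | inj₁ refl = inj₂ (inj₁ (c , [ p , q ]))
  ... | inj₂ refl | inj₂ refl = inj₂ (inj₁ (not c , [ p , q ]))
  ... | inj₂ refl | inj₁ refl = inj₂ (inj₂ (separated s t ≃-refl p q))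
  ... | inj₁ refl | inj₂ refl = inj₂ (inj₂ (separated t s swap≃ q p))
  glue (inj₂ (inj₁ (b , p))) (inj₂ (inj₂ (separated a a′ e q₁ q₂))) with bool-cases b c
  ... | inj₁ refl = inj₂ (inj₂ (separated a (node c s a′)
        (≃-trans (≃-trans (≃-sym assoc≃) (≃-trans (Node-≃ swap≃ ≃-refl) assoc≃)) (Node-≃ ≃-refl e))
        q₁ [ p , q₂ ]))
  ... | inj₂ refl = inj₂ (inj₂ (separated (node c s a) a′ (≃-trans assoc≃ (Node-≃ ≃-refl e)) [ p , q₁ ] q₂))
  glue (inj₂ (inj₂ (separated a a′ e p₁ p₂))) (inj₂ (inj₁ (b , q))) with bool-cases b c
  ... | inj₁ refl = inj₂ (inj₂ (separated a (node c a′ t)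
        (≃-trans (≃-sym assoc≃) (Node-≃ e ≃-refl)) p₁ [ p₂ , q ]))
  ... | inj₂ refl = inj₂ (inj₂ (separated (node c a t) a′
        (≃-trans assoc≃ (≃-trans (Node-≃ ≃-refl swap≃) (≃-trans (≃-sym assoc≃) (Node-≃ e ≃-refl))))
        [ p₁ , q ] p₂))
  glue (inj₂ (inj₂ (separated a a′ e p₁ p₂))) (inj₂ (inj₂ (separated b b′ f q₁ q₂))) =
    inj₂ (inj₂ (separated (node c a b) (node c a′ b′) (≃-trans shuffle (Node-≃ e f)) [ p₁ , q₁ ] [ p₂ , q₂ ]))
... | inj₂ refl with everywhere? (node d s t) N c | everywhere? (node d s t) N (not c)
... | inj₁ p | _ = inj₂ (inj₁ (c , p))
... | inj₂ _ | inj₁ p = inj₂ (inj₁ (not c , p))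
... | inj₂ (u , p) | inj₂ (w , q) = inj₁ (cross u w p (trans q (not-involutive c)))
  where
  cross : ∀ u w → N u ≡ not c → N w ≡ c → Mixed c (node (not c) s t) N
  cross (inj₁ u) (inj₂ w) p q = mixed refl p q
  cross (inj₂ u) (inj₁ w) p q = mixed refl p q
  -- Two leaves on the same side need not be related by `not c`, but any leaf of the other side is
  -- so related to both. It differs under `N` from one of the two and forms the mixed pair with that
  -- one.
  cross (inj₁ u) (inj₁ w) p q with bool-cases (N (inj₂ (root t))) c
  ... | inj₁ r = mixed {u = inj₁ u} {inj₂ (root t)} refl p r
  ... | inj₂ r = mixed {u = inj₂ (root t)} {inj₁ w} refl r q
  cross (inj₂ u) (inj₂ w) p q with bool-cases (N (inj₁ (root s))) c
  ... | inj₁ r = mixed {u = inj₂ u} {inj₁ (root s)} refl p r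
  ... | inj₂ r = mixed {u = inj₁ (root s)} {inj₂ w} refl r q

-- With v the new vertex, w − u − v − y is an induced path in the graph or, for c = true,
-- in its complement; in the graph it is then u − y − w − v.
mixed⇒P4 : ∀ c t N {u w y} → adjᵗ t u w ≡ not c → N u ≡ not c → N w ≡ c →
  N y ≡ not c → adjᵗ t u y ≡ c → adjᵗ t w y ≡ c → InducedP4 (Extend ⟪ t ⟫ N)
mixed⇒P4 false t N {u} {w} {y} uw Nu Nw Ny uy wy =
  path {a = inj₂ w} {inj₂ u} {inj₁ tt} {inj₂ y} (trans (adjᵗ-sym t w u) uw) Nu Ny Nw wy uy
mixed⇒P4 true t N {u} {w} {y} uw Nu Nw Ny uy wy =
  path {a = inj₂ u} {inj₂ y} {inj₂ w} {inj₁ tt} uy (trans (adjᵗ-sym t y w) wy) Nw uw Nu Ny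

-- The new vertex descends while it sees one side as the root label `c` prescribes. Once it does
-- not, each side has a leaf, `x` or `y`, with `N` equal to `not c`. A mixed pair is related by
-- `not c`, hence lies within one side, and the witness of the other side completes a P₄. Without a
-- mixed pair, `N` is constant, and the vertex goes above the root, or the tree regroups as
-- `node c s₁ s₂` with the vertex attached to `s₁` by `not c`.
extend : ∀ t N → InducedP4 (Extend ⟪ t ⟫ N) ⊎ (∃[ t′ ] ⟪ t′ ⟫ ≃ Extend ⟪ t ⟫ N)
extend • N = inj₂ (node (N tt) • • , Extend-const λ _ → refl)
extend (node c s t) N with everywhere? s (N ∘ inj₁) c | everywhere? t (N ∘ inj₂) c
... | inj₁ p | _ = Sum.map
      (InducedP4-↪ (↪-trans right (≃⇒↪ (Extend-right {N = N} p))))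
      (λ (t′ , e) → node c s t′ , ≃-trans (Node-≃ ≃-refl e) (Extend-right p))
      (extend t (N ∘ inj₂))
... | inj₂ _ | inj₁ q = Sum.map
      (InducedP4-↪ (↪-trans left (≃⇒↪ (Extend-left {N = N} q))))
      (λ (s′ , e) → node c s′ t , ≃-trans (Node-≃ e ≃-refl) (Extend-left q))
      (extend s (N ∘ inj₁))
... | inj₂ (x , p) | inj₂ (y , q) with separate c (node c s t) N
... | inj₂ (inj₁ (b , r)) = inj₂ (node b • (node c s t) , Extend-const r)
... | inj₂ (inj₂ (separated s₁ s₂ e r₁ r₂)) =
      inj₂ (node c (node (not c) • s₁) s₂ ,
            ≃-trans (Node-≃ (Extend-const r₁) ≃-refl) (≃-trans (Extend-left r₂) (Extend-≃ e)))
... | inj₁ (mixed {inj₁ u} {inj₁ w} e r₁ r₂) =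
      inj₁ (mixed⇒P4 c (node c s t) N {inj₁ u} {inj₁ w} {inj₂ y} e r₁ r₂ q refl refl)
... | inj₁ (mixed {inj₂ u} {inj₂ w} e r₁ r₂) =
      inj₁ (mixed⇒P4 c (node c s t) N {inj₂ u} {inj₂ w} {inj₁ x} e r₁ r₂ p refl refl)
... | inj₁ (mixed {inj₁ u} {inj₂ w} e r₁ r₂) = ⊥-elim (not-¬ refl e)
... | inj₁ (mixed {inj₂ u} {inj₁ w} e r₁ r₂) = ⊥-elim (not-¬ refl e)

cotree : ∀ {m} (r : Fin (suc m) → Fin (suc m) → Bool) →
  (∀ i j → r i j ≡ r j i) → (∀ i → r i i ≡ false) →
  InducedP4 (Fin (suc m) ,, r) ⊎ (∃[ t ] ⟪ t ⟫ ≃ (Fin (suc m) ,, r))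
cotree {zero} r r-sym r-irr = inj₂ (• , record
  { to = λ _ → zero ; from = λ _ → tt
  ; from-to = λ _ → refl ; to-from = λ { zero → refl }
  ; pres = λ _ _ → r-irr zero })
cotree {suc m} r r-sym r-irr
  with cotree (λ i j → r (suc i) (suc j)) (λ i j → r-sym (suc i) (suc j)) (λ i → r-irr (suc i))
... | inj₁ p4 = inj₁ (InducedP4-↪ (record { map = suc ; inj = suc-injective ; pres = λ _ _ → refl }) p4)
... | inj₂ (t , e) = Sum.map
      (InducedP4-↪ (≃⇒↪ whole)) (λ (t′ , e′) → t′ , ≃-trans e′ whole)
      (extend t (r zero ∘ suc ∘ _≃_.to e))
  where
  first : Extend (Fin (suc m) ,, λ i j → r (suc i) (suc j)) (r zero ∘ suc) ≃ (Fin (suc (suc m)) ,, r)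
  first = record
    { to = λ { (inj₁ _) → zero ; (inj₂ i) → suc i }
    ; from = λ { zero → inj₁ tt ; (suc i) → inj₂ i }
    ; from-to = λ { (inj₁ _) → refl ; (inj₂ _) → refl }
    ; to-from = λ { zero → refl ; (suc _) → refl }
    ; pres = λ { (inj₁ _) (inj₁ _) → r-irr zero ; (inj₁ _) (inj₂ _) → refl
               ; (inj₂ i) (inj₁ _) → r-sym (suc i) zero ; (inj₂ _) (inj₂ _) → refl } }
  whole = ≃-trans (Extend-≃ e) first

-- Polar partitions of cotrees

-- `Polar ∞ (fin 3) G` unfolds to `Polarˢ ⟨ G ⟩`, so the two are used interchangeably.
Polarˢ : Structure → Set
Polarˢ X =
  Σ[ side ∈ (Carrier X → Bool) ] Σ[ p ∈ (Carrier X → ℕ) ] Σ[ q ∈ (Carrier X → Fin 3) ]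
    (∀ u v → u ≢ v →
       (side u ≡ true → side v ≡ true → (rel X u v ≡ true ⇔ p u ≢ p v)) ×
       (side u ≡ false → side v ≡ false → (rel X u v ≡ true ⇔ q u ≡ q v)))

Polarˢ-↪ : ∀ {X Y} → X ↪ Y → Polarˢ Y → Polarˢ X
Polarˢ-↪ f (side , p , q , ok) =
  side ∘ map , p ∘ map , q ∘ map , λ u v u≢v →
    subst (λ b → (_ → _ → (b ≡ true ⇔ _)) × (_ → _ → (b ≡ true ⇔ _))) (pres u v)
          (ok (map u) (map v) (u≢v ∘ inj))
  where open _↪_ f

-- On S, the vertices related by o are exactly those with equal labels: S is a cluster
-- for o = true and complete multipartite for o = false.
Classified : Bool → (X : Structure) → (Carrier X → Bool) → {L : Set} → (Carrier X → L) → Set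
Classified o X S q = ∀ u v → u ≢ v → S u ≡ true → S v ≡ true →
  (rel X u v ≡ o → q u ≡ q v) × (q u ≡ q v → rel X u v ≡ o)

-- Class counts at a node across which everything belongs to the same class: either one side
-- contributes nothing, or each side is a single class and the two fuse.
data Merge : ℕ → ℕ → ℕ → Set where
  absorbˡ : ∀ {n} → Merge 0 n n
  absorbʳ : ∀ {m} → Merge m 0 m
  both    : Merge 1 1 1

-- A compositional form of `Classified` that also fixes the exact number of nonempty classes. At a
-- node labelled `not o` no class crosses, so the counts add; at a node labelled `o` any two members
-- across share a class.
data Classes (o : Bool) : (t : Cotree) → (Leaf t → Bool) → ℕ → Set where
  inside  : ∀ {S} → S tt ≡ true → Classes o • S 1
  outside : ∀ {S} → S tt ≡ false → Classes o • S 0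
  split   : ∀ {s t S m n} → Classes o s (S ∘ inj₁) m → Classes o t (S ∘ inj₂) n →
            Classes o (node (not o) s t) S (m + n)
  merge   : ∀ {s t S m n k} → Classes o s (S ∘ inj₁) m → Classes o t (S ∘ inj₂) n →
            Merge m n k → Classes o (node o s t) S k

classes⇒labels : ∀ {o t S m} → Classes o t S m →
  Σ[ q ∈ (Leaf t → ℕ) ] (∀ u → S u ≡ true → q u < m) × Classified o ⟪ t ⟫ S q
classes⇒labels (inside _) = (λ _ → 0) , (λ _ _ → s≤s z≤n) , λ u v u≢v → contradiction refl u≢v
classes⇒labels (outside Stt) =
  (λ _ → 0) , (λ _ S → case trans (sym Stt) S of λ ()) , λ u v u≢v → contradiction refl u≢v
classes⇒labels {o} {S = S} (split {s} {t} {m = m} {n} x y)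
  with classes⇒labels x | classes⇒labels y
... | q , q< , ok | q′ , q′< , ok′ = Q , Q< , OK
  where
  Q : Leaf (node (not o) s t) → ℕ
  Q = [ q , (λ v → m + q′ v) ]
  Q< : ∀ u → S u ≡ true → Q u < m + n
  Q< (inj₁ u) Su = ≤-trans (q< u Su) (m≤m+n m n)
  Q< (inj₂ v) Sv = +-monoʳ-< m (q′< v Sv)
  apart : ∀ u v → S (inj₁ u) ≡ true → q u ≢ m + q′ v
  apart u v Su e = <⇒≱ (q< u Su) (subst (m ≤_) (sym e) (m≤m+n m (q′ v)))
  OK : Classified o ⟪ node (not o) s t ⟫ S Q
  OK (inj₁ u) (inj₁ v) u≢v = ok u v (u≢v ∘ cong inj₁)
  OK (inj₁ u) (inj₂ v) _ Su _ = (λ e → ⊥-elim (not-¬ refl (sym e))) , ⊥-elim ∘ apart u v Su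
  OK (inj₂ u) (inj₁ v) _ _ Sv = (λ e → ⊥-elim (not-¬ refl (sym e))) , ⊥-elim ∘ apart v u Sv ∘ sym
  OK (inj₂ u) (inj₂ v) u≢v Su Sv =
    let f , g = ok′ u v (u≢v ∘ cong inj₂) Su Sv in cong (m +_) ∘ f , g ∘ +-cancelˡ-≡ m _ _
classes⇒labels {o} {S = S} (merge {s} {t} x y z) with classes⇒labels x | classes⇒labels y
... | q , q< , ok | q′ , q′< , ok′ = Q , Q< z q< q′< , OK
  where
  Q : Leaf (node o s t) → ℕ
  Q = [ q , q′ ]
  Q< : ∀ {m n k} → Merge m n k → (∀ u → S (inj₁ u) ≡ true → q u < m) →
       (∀ u → S (inj₂ u) ≡ true → q′ u < n) → ∀ u → S u ≡ true → Q u < k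
  Q< absorbˡ q< q′< (inj₁ u) Su = case q< u Su of λ ()
  Q< absorbˡ q< q′< (inj₂ u) Su = q′< u Su
  Q< absorbʳ q< q′< (inj₁ u) Su = q< u Su
  Q< absorbʳ q< q′< (inj₂ u) Su = case q′< u Su of λ ()
  Q< both    q< q′< (inj₁ u) Su = q< u Su
  Q< both    q< q′< (inj₂ u) Su = q′< u Su
  same : ∀ {m n k} → Merge m n k → ∀ {i j} → i < m → j < n → i ≡ j
  same both (s≤s z≤n) (s≤s z≤n) = refl
  OK : Classified o ⟪ node o s t ⟫ S Q
  OK (inj₁ u) (inj₁ v) u≢v = ok u v (u≢v ∘ cong inj₁)
  OK (inj₁ u) (inj₂ v) _ Su Sv = (λ _ → same z (q< u Su) (q′< v Sv)) , λ _ → refl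
  OK (inj₂ u) (inj₁ v) _ Su Sv = (λ _ → sym (same z (q< v Sv) (q′< u Su))) , λ _ → refl
  OK (inj₂ u) (inj₂ v) u≢v = ok′ u v (u≢v ∘ cong inj₂)

-- Representatives of the classes. They bound the number of classes by the number of labels, and
-- they expose the contradiction when classes that cannot merge meet at a node.
Transversal : ∀ {A L : Set} → (A → Bool) → (A → L) → ℕ → Set
Transversal {A} S q m = Σ[ g ∈ (Fin m → A) ] (∀ i → S (g i) ≡ true) × Injective _≡_ _≡_ (q ∘ g)

labels⇒classes : ∀ o t {L : Set} (S : Leaf t → Bool) (q : Leaf t → L) → Classified o ⟪ t ⟫ S q →
  ∃[ m ] Classes o t S m × Transversal S q m
labels⇒classes o • S q ok with S tt in eq
... | true  = 1 , inside eq , (λ _ → tt) , (λ _ → eq) , λ { {zero} {zero} _ → refl }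
... | false = 0 , outside eq , (λ ()) , (λ ()) , λ { {()} }
labels⇒classes o (node c s t) {L} S q ok
  with labels⇒classes o s (S ∘ inj₁) (q ∘ inj₁) (λ u v u≢v → ok _ _ (u≢v ∘ inj₁-injective))
     | labels⇒classes o t (S ∘ inj₂) (q ∘ inj₂) (λ u v u≢v → ok _ _ (u≢v ∘ inj₂-injective))
     | bool-cases c o
... | m , x , g , Sg , g-inj | n , y , h , Sh , h-inj | inj₂ refl =
  m + n , split x y , G ∘ splitAt m , SG ∘ splitAt m ,
  λ {i} {j} e → trans (sym (join-splitAt m n i)) (trans (cong (join m n) (G-inj (splitAt m i) (splitAt m j) e)) (join-splitAt m n j))
  where
  G : Fin m ⊎ Fin n → Leaf (node (not o) s t)
  G = Sum.map g h
  SG : ∀ i → S (G i) ≡ true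
  SG (inj₁ i) = Sg i
  SG (inj₂ i) = Sh i
  G-inj : ∀ i j → q (G i) ≡ q (G j) → i ≡ j
  G-inj (inj₁ i) (inj₁ j) e = cong inj₁ (g-inj e)
  G-inj (inj₂ i) (inj₂ j) e = cong inj₂ (h-inj e)
  G-inj (inj₁ i) (inj₂ j) e = ⊥-elim (not-¬ refl (sym (proj₂ (ok _ _ (λ ()) (Sg i) (Sh j)) e)))
  G-inj (inj₂ i) (inj₁ j) e = ⊥-elim (not-¬ refl (sym (proj₂ (ok _ _ (λ ()) (Sh i) (Sg j)) e)))
... | zero , x , _ | n , y , h , Sh , h-inj | inj₁ refl =
  n , merge x y absorbˡ , inj₂ ∘ h , Sh , h-inj
... | m , x , g , Sg , g-inj | zero , y , _ | inj₁ refl =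
  m , merge x y absorbʳ , inj₁ ∘ g , Sg , g-inj
... | 1 , x , g , Sg , g-inj | 1 , y , h , Sh , h-inj | inj₁ refl =
  1 , merge x y both , inj₁ ∘ g , Sg , g-inj
-- Two representatives with different labels on the left would both share the label of one member on
-- the right.
... | suc (suc m) , x , g , Sg , g-inj | suc n , y , h , Sh , h-inj | inj₁ refl =
  case g-inj (trans (meet zero) (sym (meet (suc zero)))) of λ ()
  where
  meet : ∀ i → q (inj₁ (g i)) ≡ q (inj₂ (h zero))
  meet i = proj₁ (ok _ _ (λ ()) (Sg i) (Sh zero)) refl
... | suc m , x , g , Sg , g-inj | suc (suc n) , y , h , Sh , h-inj | inj₁ refl =
  case h-inj (trans (sym (meet zero)) (meet (suc zero))) of λ ()
  where
  meet : ∀ i → q (inj₁ (g zero)) ≡ q (inj₂ (h i))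
  meet i = proj₁ (ok _ _ (λ ()) (Sg zero) (Sh i)) refl

Partition : Cotree → ℕ → ℕ → Set
Partition t a b = Σ[ side ∈ (Leaf t → Bool) ] Classes false t side a × Classes true t (not ∘ side) b

partition⇒polar : ∀ {t a b} → Partition t a b → b ≤ 3 → Polarˢ ⟪ t ⟫
partition⇒polar {t} (side , x , y) b≤3 with classes⇒labels x | classes⇒labels y
... | p , _ , okᵖ | q , q< , okᵠ = side , p , (λ u → q̂ u (q u <? 3)) , λ u v u≢v →
      (λ Su Sv → let f , g = okᵖ u v u≢v Su Sv in
        mk⇔ (λ uv e → case trans (sym uv) (g e) of λ ()) (λ ne → ¬-not (ne ∘ f)))
    , (λ Su Sv → let f , g = okᵠ u v u≢v (cong not Su) (cong not Sv) in
        mk⇔ (λ uv → q̂-cong (q u <? 3) (q v <? 3) (f uv))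
            (λ e → g (q̂-inj (≤-trans (q< u (cong not Su)) b≤3) (≤-trans (q< v (cong not Sv)) b≤3) (q u <? 3) (q v <? 3) e)))
  where
  -- Labels are known to be below `b` only on the cluster side; elsewhere `zero` is a default.
  q̂ : ∀ u → Dec (q u < 3) → Fin 3
  q̂ u (yes q<3) = fromℕ< q<3
  q̂ u (no _)    = zero
  q̂-cong : ∀ {u v} d d′ → q u ≡ q v → q̂ u d ≡ q̂ v d′
  q̂-cong (yes d) (yes d′) e = fromℕ<-cong _ _ e d d′
  q̂-cong (no _)  (no _)   e = refl
  q̂-cong (yes d) (no d′)  e = contradiction (subst (_< 3) e d) d′
  q̂-cong (no d)  (yes d′) e = contradiction (subst (_< 3) (sym e) d′) d
  q̂-inj : ∀ {u v} → q u < 3 → q v < 3 → ∀ d d′ → q̂ u d ≡ q̂ v d′ → q u ≡ q v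
  q̂-inj _ _ (yes d) (yes d′) e = fromℕ<-injective _ _ d d′ e
  q̂-inj l _ (no d)  _        e = contradiction l d
  q̂-inj _ l _       (no d)   e = contradiction l d

polar⇒partition : ∀ t → Polarˢ ⟪ t ⟫ → ∃[ a ] ∃[ b ] Partition t a b × b ≤ 3
polar⇒partition t (side , p , q , ok)
  with labels⇒classes false t side p (λ u v u≢v Su Sv →
         let open Equivalence (proj₁ (ok u v u≢v) Su Sv) in
         (λ uv → decidable-stable (p u ≟ p v) (λ ne → case trans (sym uv) (from ne) of λ ()))
       , (λ e → ¬-not (λ uv → to uv e)))
     | labels⇒classes true t (not ∘ side) q (λ u v u≢v Su Sv →
         let open Equivalence (proj₂ (ok u v u≢v) (not-injective Su) (not-injective Sv)) in to , from)
... | a , x , _ | b , y , g , _ , g-inj = a , b , (side , x , y) , injective⇒≤ g-inj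

-- Profiles: composition, attainment and lower bounds

infixl 6 _⊹_ _⋎_

_⊹_ : ℕ → ℕ → ℕ
m ⊹ n = 4 ⊓ (m + n)

-- `Merge` as an operation on least counts, with 4 for sides that cannot be merged: across a join a
-- cluster is one-sided or a single clique.
_⋎_ : ℕ → ℕ → ℕ
0     ⋎ n     = n
suc m ⋎ 0     = suc m
1     ⋎ 1     = 1
suc m ⋎ suc n = 4

-- ⟨ c ∣ b ∣ a ⟩ records the least number of clusters in a polar partition (A, B) with A
-- empty, with A independent, and with A arbitrary; every value ≥ 4 (or no such
-- partition) is recorded as 4.
data Profile : Set where
  ⟨_∣_∣_⟩ : ℕ → ℕ → ℕ → Profile

least∅ least₁ least : Profile → ℕ
least∅ ⟨ c ∣ _ ∣ _ ⟩ = c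
least₁ ⟨ _ ∣ b ∣ _ ⟩ = b
least  ⟨ _ ∣ _ ∣ a ⟩ = a

compose : Bool → Profile → Profile → Profile
compose false ⟨ c ∣ b ∣ a ⟩ ⟨ c′ ∣ b′ ∣ a′ ⟩ = ⟨ c ⊹ c′ ∣ b ⊹ b′ ∣ (b ⊹ b′) ⊓ ((a ⊹ c′) ⊓ (c ⊹ a′)) ⟩
compose true  ⟨ c ∣ b ∣ a ⟩ ⟨ c′ ∣ b′ ∣ a′ ⟩ = ⟨ c ⋎ c′ ∣ (b ⋎ c′) ⊓ (c ⋎ b′) ∣ a ⋎ a′ ⟩

prof : Cotree → Profile
prof •            = ⟨ 1 ∣ 0 ∣ 0 ⟩
prof (node c s t) = compose c (prof s) (prof t)

partition-∪ : ∀ {s t a a′ a″ b b′} → Merge a a′ a″ → Partition s a b → Partition t a′ b′ →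
  Partition (s ∪ t) a″ (b + b′)
partition-∪ z (S , x , y) (S′ , x′ , y′) = [ S , S′ ] , merge x x′ z , split y y′

partition-⋈ : ∀ {s t a a′ b b′ b″} → Merge b b′ b″ → Partition s a b → Partition t a′ b′ →
  Partition (s ⋈ t) (a + a′) b″
partition-⋈ z (S , x , y) (S′ , x′ , y′) = [ S , S′ ] , split x x′ , merge y y′ z

⊹-exact : ∀ m n → m ⊹ n < 4 → m ⊹ n ≡ m + n
⊹-exact m n lt with ⊓-sel 4 (m + n)
... | inj₁ e = contradiction (subst (_< 4) e lt) (<-irrefl refl)
... | inj₂ e = e

⋎-merge : ∀ m n → m ⋎ n < 4 → Merge m n (m ⋎ n)
⋎-merge 0             n             _  = absorbˡ
⋎-merge (suc m)       0             _  = absorbʳ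
⋎-merge 1             1             _  = both
⋎-merge 1             (suc (suc n)) lt = contradiction lt (<-irrefl refl)
⋎-merge (suc (suc m)) (suc n)       lt = contradiction lt (<-irrefl refl)

⊹-small : ∀ m n → m ⊹ n < 4 → m < 4 × n < 4
⊹-small m n lt = ≤-<-trans (m≤m+n m n) lt′ , ≤-<-trans (m≤n+m n m) lt′
  where lt′ = subst (_< 4) (⊹-exact m n lt) lt

⋎-small : ∀ m n → m ⋎ n < 4 → m < 4 × n < 4
⋎-small 0             n             lt = s≤s z≤n , lt
⋎-small (suc m)       0             lt = lt , s≤s z≤n
⋎-small 1             1             lt = lt , lt
⋎-small 1             (suc (suc n)) lt = contradiction lt (<-irrefl refl)
⋎-small (suc (suc m)) (suc n)       lt = contradiction lt (<-irrefl refl)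

≤1-merge : ∀ {m n} → m ≤ 1 → n ≤ 1 → ∃[ k ] k ≤ 1 × Merge m n k
≤1-merge z≤n       n≤1       = _ , n≤1 , absorbˡ
≤1-merge (s≤s z≤n) z≤n       = _ , s≤s z≤n , absorbʳ
≤1-merge (s≤s z≤n) (s≤s z≤n) = _ , s≤s z≤n , both

Independent Arbitrary : Cotree → ℕ → Set
Independent t k = ∃[ a ] a ≤ 1 × Partition t a k
Arbitrary   t k = ∃[ a ] Partition t a k

-- Attainment half of the correctness of profiles. It is restricted to values below 4, since 4 also
-- codes the absence of a partition.
record Realised (t : Cotree) (p : Profile) : Set where
  field
    empty       : least∅ p < 4 → Partition t 0 (least∅ p)
    independent : least₁ p < 4 → Independent t (least₁ p)
    arbitrary   : least p < 4 → Arbitrary t (least p)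

⊓-elim : ∀ (P : ℕ → Set) m n → (m < 4 → P m) → (n < 4 → P n) → m ⊓ n < 4 → P (m ⊓ n)
⊓-elim P m n f g lt with ⊓-sel m n
... | inj₁ e = subst P (sym e) (f (subst (_< 4) e lt))
... | inj₂ e = subst P (sym e) (g (subst (_< 4) e lt))

realised : ∀ t → Realised t (prof t)
realised • = record
  { empty       = λ _ → (λ _ → false) , outside refl , inside refl
  ; independent = λ _ → 1 , s≤s z≤n , (λ _ → true) , inside refl , outside refl
  ; arbitrary   = λ _ → 1 , (λ _ → true) , inside refl , outside refl }
realised (s ∪ t) with prof s | prof t | realised s | realised t
... | ⟨ c ∣ b ∣ a ⟩ | ⟨ c′ ∣ b′ ∣ a′ ⟩ | S | T = record
  { empty       = sum (Partition (s ∪ t) 0) c c′ λ lt lt′ → partition-∪ absorbˡ (S.empty lt) (T.empty lt′)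
  ; independent = sum (Independent (s ∪ t)) b b′ both-independent
  ; arbitrary   = ⊓-elim (Arbitrary (s ∪ t)) (b ⊹ b′) ((a ⊹ c′) ⊓ (c ⊹ a′))
      (λ lt → let _ , _ , x = sum (Independent (s ∪ t)) b b′ both-independent lt in _ , x)
      (⊓-elim (Arbitrary (s ∪ t)) (a ⊹ c′) (c ⊹ a′)
        (sum (Arbitrary (s ∪ t)) a c′ λ lt lt′ → _ , partition-∪ absorbʳ (proj₂ (S.arbitrary lt)) (T.empty lt′))
        (sum (Arbitrary (s ∪ t)) c a′ λ lt lt′ → _ , partition-∪ absorbˡ (S.empty lt) (proj₂ (T.arbitrary lt′)))) }
  where
  module S = Realised S
  module T = Realised T
  sum : ∀ (Q : ℕ → Set) m n → (m < 4 → n < 4 → Q (m + n)) → m ⊹ n < 4 → Q (m ⊹ n)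
  sum Q m n f lt = let l , r = ⊹-small m n lt in subst Q (sym (⊹-exact m n lt)) (f l r)
  both-independent : b < 4 → b′ < 4 → Independent (s ∪ t) (b + b′)
  both-independent lt lt′ =
    let _ , l , x = S.independent lt
        _ , l′ , x′ = T.independent lt′
        _ , l″ , z = ≤1-merge l l′
    in _ , l″ , partition-∪ z x x′
realised (s ⋈ t) with prof s | prof t | realised s | realised t
... | ⟨ c ∣ b ∣ a ⟩ | ⟨ c′ ∣ b′ ∣ a′ ⟩ | S | T = record
  { empty       = sum (Partition (s ⋈ t) 0) c c′ λ z lt lt′ → partition-⋈ z (S.empty lt) (T.empty lt′)
  ; independent = ⊓-elim (Independent (s ⋈ t)) (b ⋎ c′) (c ⋎ b′)
      (sum (Independent (s ⋈ t)) b c′ λ z lt lt′ → let a , l , x = S.independent lt in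
        a + 0 , subst (_≤ 1) (sym (+-identityʳ a)) l , partition-⋈ z x (T.empty lt′))
      (sum (Independent (s ⋈ t)) c b′ λ z lt lt′ → let a , l , x = T.independent lt′ in
        a , l , partition-⋈ z (S.empty lt) x)
  ; arbitrary   = sum (Arbitrary (s ⋈ t)) a a′ λ z lt lt′ →
      _ , partition-⋈ z (proj₂ (S.arbitrary lt)) (proj₂ (T.arbitrary lt′)) }
  where
  module S = Realised S
  module T = Realised T
  sum : ∀ (Q : ℕ → Set) m n → (∀ {k} → Merge m n k → m < 4 → n < 4 → Q k) → m ⋎ n < 4 → Q (m ⋎ n)
  sum Q m n f lt = let l , r = ⋎-small m n lt in f (⋎-merge m n lt) l r

small⇒polar : ∀ t → least (prof t) < 4 → Polarˢ ⟪ t ⟫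
small⇒polar t lt = partition⇒polar (proj₂ (Realised.arbitrary (realised t) lt)) (≤-pred lt)

⊹-mono : ∀ {m n m′ n′} → m ≤ m′ → n ≤ n′ → m ⊹ n ≤ m′ + n′
⊹-mono l r = ≤-trans (m⊓n≤n 4 _) (+-mono-≤ l r)

-- The value 4 for incompatible sides does no harm here: when the larger counts merge, the smaller
-- ones merge as well.
⋎-mono : ∀ {m n m′ n′ k} → Merge m′ n′ k → m ≤ m′ → n ≤ n′ → m ⋎ n ≤ k
⋎-mono absorbˡ z≤n r = r
⋎-mono absorbʳ z≤n z≤n = z≤n
⋎-mono absorbʳ (s≤s l) z≤n = s≤s l
⋎-mono both z≤n r = r
⋎-mono both (s≤s z≤n) z≤n = s≤s z≤n
⋎-mono both (s≤s z≤n) (s≤s z≤n) = s≤s z≤n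

-- Lower-bound half: what the mere existence of a partition with `a` parts and `b` clusters says
-- about the recorded values.
record _Bounds⟨_,_⟩ (p : Profile) (a b : ℕ) : Set where
  field
    empty       : a ≡ 0 → least∅ p ≤ b
    independent : a ≤ 1 → least₁ p ≤ b
    arbitrary   : least p ≤ b

bounds : ∀ t {a b} → Partition t a b → prof t Bounds⟨ a , b ⟩
bounds • (_ , inside _ , inside _)   = record { empty = λ () ; independent = λ _ → z≤n ; arbitrary = z≤n }
bounds • (_ , inside _ , outside _)  = record { empty = λ () ; independent = λ _ → z≤n ; arbitrary = z≤n }
bounds • (_ , outside _ , inside _)  = record { empty = λ _ → s≤s z≤n ; independent = λ _ → z≤n ; arbitrary = z≤n }
bounds • (_ , outside p , outside q) = case trans (sym q) (cong not p) of λ ()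
bounds (s ∪ t) {a″} (S , merge {m = a} {a′} x x′ z , split {m = k} {k′} y y′)
  with prof s | prof t | bounds s (S ∘ inj₁ , x , y) | bounds t (S ∘ inj₂ , x′ , y′)
... | ⟨ c ∣ b ∣ d ⟩ | ⟨ c′ ∣ b′ ∣ d′ ⟩ | I | I′ = record
  { empty       = λ e → ⊹-mono (I.empty (proj₁ (zeros z e))) (I′.empty (proj₂ (zeros z e)))
  ; independent = independent
  ; arbitrary   = arbitrary z refl refl }
  where
  module I = _Bounds⟨_,_⟩ I
  module I′ = _Bounds⟨_,_⟩ I′
  zeros : ∀ {a a′ a″} → Merge a a′ a″ → a″ ≡ 0 → a ≡ 0 × a′ ≡ 0
  zeros absorbˡ e = refl , e
  zeros absorbʳ e = e , refl
  ones : ∀ {a a′ a″} → Merge a a′ a″ → a″ ≤ 1 → a ≤ 1 × a′ ≤ 1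
  ones absorbˡ l = z≤n , l
  ones absorbʳ l = l , z≤n
  ones both    l = l , l
  independent : a″ ≤ 1 → b ⊹ b′ ≤ k + k′
  independent l = ⊹-mono (I.independent (proj₁ (ones z l))) (I′.independent (proj₂ (ones z l)))
  -- Each way of merging selects the term of the minimum to compare with: parts on the right only,
  -- on the left only, or one part that meets both sides.
  arbitrary : ∀ {m m′} → Merge m m′ a″ → a ≡ m → a′ ≡ m′ → (b ⊹ b′) ⊓ ((d ⊹ c′) ⊓ (c ⊹ d′)) ≤ k + k′
  arbitrary absorbˡ e _ = ≤-trans (m⊓n≤n (b ⊹ b′) _) (≤-trans (m⊓n≤n (d ⊹ c′) _) (⊹-mono (I.empty e) I′.arbitrary))
  arbitrary absorbʳ _ e = ≤-trans (m⊓n≤n (b ⊹ b′) _) (≤-trans (m⊓n≤m (d ⊹ c′) _) (⊹-mono I.arbitrary (I′.empty e)))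
  arbitrary both    _ _ = ≤-trans (m⊓n≤m (b ⊹ b′) _) (independent ≤-refl)
bounds (s ⋈ t) (S , split {m = a} {a′} x x′ , merge {m = k} {k′} {k″} y y′ z)
  with prof s | prof t | bounds s (S ∘ inj₁ , x , y) | bounds t (S ∘ inj₂ , x′ , y′)
... | ⟨ c ∣ b ∣ d ⟩ | ⟨ c′ ∣ b′ ∣ d′ ⟩ | I | I′ = record
  { empty       = λ e → ⋎-mono z (I.empty (m+n≡0⇒m≡0 a e)) (I′.empty (m+n≡0⇒n≡0 a e))
  ; independent = independent a a′ refl refl
  ; arbitrary   = ⋎-mono z I.arbitrary I′.arbitrary }
  where
  module I = _Bounds⟨_,_⟩ I
  module I′ = _Bounds⟨_,_⟩ I′
  independent : ∀ m m′ → a ≡ m → a′ ≡ m′ → m + m′ ≤ 1 → (b ⋎ c′) ⊓ (c ⋎ b′) ≤ k″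
  independent zero    m′   e e′ l =
    ≤-trans (m⊓n≤n (b ⋎ c′) _) (⋎-mono z (I.empty e) (I′.independent (subst (_≤ 1) (sym e′) l)))
  independent (suc zero) zero e e′ l =
    ≤-trans (m⊓n≤m (b ⋎ c′) _) (⋎-mono z (I.independent (subst (_≤ 1) (sym e) l)) (I′.empty e′))
  independent (suc zero) (suc _) e e′ (s≤s ())
  independent (suc (suc _)) _ e e′ (s≤s ())

polar⇒small : ∀ t → Polarˢ ⟪ t ⟫ → least (prof t) < 4
polar⇒small t polar with polar⇒partition t polar
... | _ , _ , x , b≤3 = s≤s (≤-trans (_Bounds⟨_,_⟩.arbitrary (bounds t x)) b≤3)

-- Deletion of superfluous leaves, and canonical forms

-- The comparisons are Boolean because they are run by evaluation on thousands of cotrees; proofs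
-- are recovered from the answers afterwards.
_==_ : Cotree → Cotree → Bool
•          == •             = true
•          == node _ _ _    = false
node _ _ _ == •             = false
node c s t == node c′ s′ t′ = does (c Bool.≟ c′) ∧ ((s == s′) ∧ (t == t′))

==-sound : ∀ s t → T (s == t) → s ≡ t
==-sound • • _ = refl
==-sound (node c s t) (node c′ s′ t′) e with c Bool.≟ c′
... | yes refl = let p , q = Equivalence.to T-∧ e in cong₂ (node c) (==-sound s s′ p) (==-sound t t′ q)

_∈ᵇ_ : Cotree → List Cotree → Bool
t ∈ᵇ []       = false
t ∈ᵇ (u ∷ us) = (t == u) ∨ (t ∈ᵇ us)

∈ᵇ-sound : ∀ t us → T (t ∈ᵇ us) → t ∈ us
∈ᵇ-sound t (u ∷ us) e with Equivalence.to (T-∨ {t == u}) e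
... | inj₁ p = here (==-sound t u p)
... | inj₂ q = there (∈ᵇ-sound t us q)

_==ᵖ_ : Profile → Profile → Bool
⟨ c ∣ b ∣ a ⟩ ==ᵖ ⟨ c′ ∣ b′ ∣ a′ ⟩ = (c ≡ᵇ c′) ∧ ((b ≡ᵇ b′) ∧ (a ≡ᵇ a′))

==ᵖ-sound : ∀ p q → T (p ==ᵖ q) → p ≡ q
==ᵖ-sound ⟨ c ∣ b ∣ a ⟩ ⟨ c′ ∣ b′ ∣ a′ ⟩ e
  with Equivalence.to (T-∧ {c ≡ᵇ c′}) e
... | p , e′ with Equivalence.to (T-∧ {b ≡ᵇ b′}) e′
... | q , r with refl ← ≡ᵇ⇒≡ c c′ p | refl ← ≡ᵇ⇒≡ b b′ q | refl ← ≡ᵇ⇒≡ a a′ r = refl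

-- Lexicographic, with the leaf first and unions before joins. Only the success of the list lookups
-- depends on this choice; `sort-≃` would hold for any Boolean comparison.
_≼_ : Cotree → Cotree → Bool
•          ≼ _             = true
node _ _ _ ≼ •             = false
node c s t ≼ node c′ s′ t′ =
  if does (c Bool.≟ c′) then (if s == s′ then t ≼ t′ else s ≼ s′) else c′

pair : Bool → Cotree → Cotree → Cotree
pair c s t = if s ≼ t then node c s t else node c t s

insert : Bool → Cotree → Cotree → Cotree
insert c x • = node c • x
insert c x (node d y u) with c Bool.≟ d | x ≼ y
... | yes _ | true  = node c x (node d y u)
... | yes _ | false = node c y (insert c x u)
... | no _  | _     = pair c x (node d y u)

insertAll : Bool → Cotree → Cotree → Cotree
insertAll c • t = insert c • t
insertAll c (node d x u) t with c Bool.≟ d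
... | yes _ = insert c x (insertAll c u t)
... | no _  = insert c (node d x u) t

-- Every maximal chain of equally labelled nodes becomes a right comb with sorted entries.
sort : Cotree → Cotree
sort •            = •
sort (node c s t) = insertAll c (sort s) (sort t)

pair-≃ : ∀ c s t → ⟪ pair c s t ⟫ ≃ ⟪ node c s t ⟫
pair-≃ c s t with s ≼ t
... | true  = ≃-refl
... | false = swap≃

insert-≃ : ∀ c x t → ⟪ insert c x t ⟫ ≃ ⟪ node c x t ⟫
insert-≃ c x • = swap≃
insert-≃ c x (node d y u) with c Bool.≟ d | x ≼ y
... | yes refl | true  = ≃-refl
... | yes refl | false =
  ≃-trans (Node-≃ ≃-refl (insert-≃ c x u)) (≃-trans (≃-sym assoc≃) (≃-trans (Node-≃ swap≃ ≃-refl) assoc≃))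
... | no _     | _     = pair-≃ c x (node d y u)

insertAll-≃ : ∀ c s t → ⟪ insertAll c s t ⟫ ≃ ⟪ node c s t ⟫
insertAll-≃ c • t = insert-≃ c • t
insertAll-≃ c (node d x u) t with c Bool.≟ d
... | yes refl =
  ≃-trans (insert-≃ c x (insertAll c u t)) (≃-trans (Node-≃ ≃-refl (insertAll-≃ c u t)) (≃-sym assoc≃))
... | no _     = insert-≃ c (node d x u) t

sort-≃ : ∀ t → ⟪ sort t ⟫ ≃ ⟪ t ⟫
sort-≃ •            = ≃-refl
sort-≃ (node c s t) = ≃-trans (insertAll-≃ c (sort s) (sort t)) (Node-≃ (sort-≃ s) (sort-≃ t))

-- `nothing` is the empty graph. Its zero profile is neutral for `compose` on profiles of cotrees,
-- so a context can be evaluated with a subtree deleted.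
prof? : Maybe Cotree → Profile
prof? nothing  = ⟨ 0 ∣ 0 ∣ 0 ⟩
prof? (just t) = prof t

node? : Bool → Maybe Cotree → Maybe Cotree → Maybe Cotree
node? c nothing  t        = t
node? c (just s) nothing  = just s
node? c (just s) (just t) = just (node c s t)

-- Drops, from left to right, every subtree whose absence from the context keep accepts.
shrink shrinkInside : (Profile → Bool) → Cotree → Maybe Cotree
shrinkRight : (Profile → Bool) → Bool → Maybe Cotree → Profile → Cotree → Maybe Cotree

shrink keep t = if keep ⟨ 0 ∣ 0 ∣ 0 ⟩ then nothing else shrinkInside keep t

shrinkInside keep • = just •
shrinkInside keep (node c s t) = go (prof t)
  where
  go : Profile → Maybe Cotree
  go p = let s′ = shrink (λ q → keep (compose c q p)) s in shrinkRight keep c s′ (prof? s′) t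

shrinkRight keep c s p t = node? c s (shrink (λ q → keep (compose c p q)) t)

Inside : Cotree → Maybe Cotree → Set
Inside t nothing  = ⊤
Inside t (just s) = ⟪ s ⟫ ↪ ⟪ t ⟫

node?-inside : ∀ c {s t} s′ t′ → Inside s s′ → Inside t t′ → Inside (node c s t) (node? c s′ t′)
node?-inside c nothing  nothing  _ _ = tt
node?-inside c nothing  (just _) _ g = ↪-trans g right
node?-inside c (just _) nothing  f _ = ↪-trans f left
node?-inside c (just _) (just _) f g = Node-↪ f g

shrink-inside : ∀ keep t → Inside t (shrink keep t)
shrink-inside keep t with keep ⟨ 0 ∣ 0 ∣ 0 ⟩
shrink-inside keep t            | true  = tt
shrink-inside keep •            | false = ↪-refl
shrink-inside keep (node c s t) | false =
  let s′ = shrink (λ q → keep (compose c q (prof t))) s in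
  node?-inside c s′ (shrink (λ q → keep (compose c (prof? s′) q)) t)
    (shrink-inside _ s) (shrink-inside _ t)

-- The profile of the sorted result is recomputed and compared, so `shrink` is only a search: what
-- has to be proved about it is that its result embeds. In the nonpolar case membership in `big` is
-- the whole claim.
listed? : Profile → List Cotree → List Cotree → Cotree → Bool
listed? p big small r = if least p <ᵇ 4 then (r ∈ᵇ small) ∧ (prof r ==ᵖ p) else r ∈ᵇ big

-- Whether deleting leaves of t without changing its profile leads to a member of small,
-- or to a member of big if t is not polar.
reduces : List Cotree → List Cotree → Cotree → Bool
reduces big small t = go (prof t)
  where
  found : Profile → Maybe Cotree → Bool
  found p nothing  = false
  found p (just r) = listed? p big small (sort r)
  go : Profile → Bool
  go p = found p (shrink (p ==ᵖ_) t)

reduces-sound : ∀ big small t → T (reduces big small t) →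
  (∃[ o ] o ∈ big × ⟪ o ⟫ ↪ ⟪ t ⟫) ⊎ (∃[ s ] s ∈ small × ⟪ s ⟫ ↪ ⟪ t ⟫ × prof s ≡ prof t)
reduces-sound big small t ok with shrink (prof t ==ᵖ_) t | shrink-inside (prof t ==ᵖ_) t
... | just r | f with least (prof t) <ᵇ 4
... | true  = let p , q = Equivalence.to T-∧ ok in
              inj₂ (sort r , ∈ᵇ-sound _ small p , ↪-trans (≃⇒↪ (sort-≃ r)) f , ==ᵖ-sound _ _ q)
... | false = inj₁ (sort r , ∈ᵇ-sound _ big ok , ↪-trans (≃⇒↪ (sort-≃ r)) f)

-- Cotrees of the listed graphs

-- mkGraph removes the diagonal and symmetrises.
mask : ∀ {m} (x y : Fin m) {a b c} → a ≡ c → b ≡ c → (x ≡ y → c ≡ false) →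
  not (does (x Fin.≟ y)) ∧ (a ∨ b) ≡ c
mask x y {c = c} refl refl diag with x Fin.≟ y
... | yes e = sym (diag e)
... | no _  = ∨-idem c

join-injective : ∀ m n (u v : Fin m ⊎ Fin n) → join m n u ≡ join m n v → u ≡ v
join-injective m n u v e =
  trans (sym (splitAt-join m n u)) (trans (cong (splitAt m) e) (splitAt-join m n v))

adj-∔ : ∀ G H u v → adj (G ∔ H) (join (n G) (n H) u) (join (n G) (n H) v) ≡ rel (Node false ⟨ G ⟩ ⟨ H ⟩) u v
adj-∔ G H u@(inj₁ x) v@(inj₁ y) rewrite splitAt-join (n G) (n H) u | splitAt-join (n G) (n H) v =
  mask (join _ _ u) (join _ _ v) refl (adj-sym G y x)
    λ e → case join-injective _ _ u v e of λ { refl → adj-irr G x }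
adj-∔ G H u@(inj₁ x) v@(inj₂ y) rewrite splitAt-join (n G) (n H) u | splitAt-join (n G) (n H) v =
  mask (join _ _ u) (join _ _ v) refl refl λ e → case join-injective _ _ u v e of λ ()
adj-∔ G H u@(inj₂ x) v@(inj₁ y) rewrite splitAt-join (n G) (n H) u | splitAt-join (n G) (n H) v =
  mask (join _ _ u) (join _ _ v) refl refl λ e → case join-injective _ _ u v e of λ ()
adj-∔ G H u@(inj₂ x) v@(inj₂ y) rewrite splitAt-join (n G) (n H) u | splitAt-join (n G) (n H) v =
  mask (join _ _ u) (join _ _ v) refl (adj-sym H y x)
    λ e → case join-injective _ _ u v e of λ { refl → adj-irr H x }

adj-⊕ : ∀ G H u v → adj (G ⊕ H) (join (n G) (n H) u) (join (n G) (n H) v) ≡ rel (Node true ⟨ G ⟩ ⟨ H ⟩) u v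
adj-⊕ G H u@(inj₁ x) v@(inj₁ y) rewrite splitAt-join (n G) (n H) u | splitAt-join (n G) (n H) v =
  mask (join _ _ u) (join _ _ v) refl (adj-sym G y x)
    λ e → case join-injective _ _ u v e of λ { refl → adj-irr G x }
adj-⊕ G H u@(inj₁ x) v@(inj₂ y) rewrite splitAt-join (n G) (n H) u | splitAt-join (n G) (n H) v =
  mask (join _ _ u) (join _ _ v) refl refl λ e → case join-injective _ _ u v e of λ ()
adj-⊕ G H u@(inj₂ x) v@(inj₁ y) rewrite splitAt-join (n G) (n H) u | splitAt-join (n G) (n H) v =
  mask (join _ _ u) (join _ _ v) refl refl λ e → case join-injective _ _ u v e of λ ()
adj-⊕ G H u@(inj₂ x) v@(inj₂ y) rewrite splitAt-join (n G) (n H) u | splitAt-join (n G) (n H) v =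
  mask (join _ _ u) (join _ _ v) refl (adj-sym H y x)
    λ e → case join-injective _ _ u v e of λ { refl → adj-irr H x }

Node≃∔ : ∀ G H → Node false ⟨ G ⟩ ⟨ H ⟩ ≃ ⟨ G ∔ H ⟩
Node≃∔ G H = record
  { to = join (n G) (n H) ; from = splitAt (n G)
  ; from-to = splitAt-join (n G) (n H) ; to-from = join-splitAt (n G) (n H) ; pres = adj-∔ G H }

Node≃⊕ : ∀ G H → Node true ⟨ G ⟩ ⟨ H ⟩ ≃ ⟨ G ⊕ H ⟩
Node≃⊕ G H = record
  { to = join (n G) (n H) ; from = splitAt (n G)
  ; from-to = splitAt-join (n G) (n H) ; to-from = join-splitAt (n G) (n H) ; pres = adj-⊕ G H }

-- `k ∙ G` always ends with the summand `edgeless 0`, which no cotree can represent and which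
-- therefore has to be absorbed.
Node-empty : ∀ {X} → X ≃ Node false X ⟨ edgeless 0 ⟩
Node-empty = record
  { to = inj₁ ; from = λ { (inj₁ u) → u }
  ; from-to = λ _ → refl ; to-from = λ { (inj₁ _) → refl } ; pres = λ _ _ → refl }

adj-complement : ∀ G u v → u ≢ v → adj (complement G) u v ≡ not (adj G u v)
adj-complement G u v u≢v = mask u v refl (cong not (adj-sym G v u)) (⊥-elim ∘ u≢v)

dual : Cotree → Cotree
dual •            = •
dual (node c s t) = node (not c) (dual s) (dual t)

toDual : ∀ t → Leaf t → Leaf (dual t)
toDual •            = id
toDual (node c s t) = Sum.map (toDual s) (toDual t)

fromDual : ∀ t → Leaf (dual t) → Leaf t
fromDual •            = id
fromDual (node c s t) = Sum.map (fromDual s) (fromDual t)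

from-toDual : ∀ t u → fromDual t (toDual t u) ≡ u
from-toDual •            _        = refl
from-toDual (node c s t) (inj₁ u) = cong inj₁ (from-toDual s u)
from-toDual (node c s t) (inj₂ u) = cong inj₂ (from-toDual t u)

to-fromDual : ∀ t u → toDual t (fromDual t u) ≡ u
to-fromDual •            _        = refl
to-fromDual (node c s t) (inj₁ u) = cong inj₁ (to-fromDual s u)
to-fromDual (node c s t) (inj₂ u) = cong inj₂ (to-fromDual t u)

adj-fromDual : ∀ t u v → u ≢ v → not (adjᵗ t (fromDual t u) (fromDual t v)) ≡ adjᵗ (dual t) u v
adj-fromDual •            _        _        u≢v = contradiction refl u≢v
adj-fromDual (node c s t) (inj₁ u) (inj₁ v) u≢v = adj-fromDual s u v (u≢v ∘ cong inj₁)
adj-fromDual (node c s t) (inj₁ _) (inj₂ _) _   = refl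
adj-fromDual (node c s t) (inj₂ _) (inj₁ _) _   = refl
adj-fromDual (node c s t) (inj₂ u) (inj₂ v) u≢v = adj-fromDual t u v (u≢v ∘ cong inj₂)

adjᵗ-irr : ∀ t u → adjᵗ t u u ≡ false
adjᵗ-irr •            _        = refl
adjᵗ-irr (node c s t) (inj₁ u) = adjᵗ-irr s u
adjᵗ-irr (node c s t) (inj₂ u) = adjᵗ-irr t u

dual-≃ : ∀ {t G} → ⟪ t ⟫ ≃ ⟨ G ⟩ → ⟪ dual t ⟫ ≃ ⟨ complement G ⟩
dual-≃ {t} {G} e = record
  { to = f ; from = toDual t ∘ from
  ; from-to = from∘f
  ; to-from = λ v → trans (cong to (from-toDual t _)) (to-from v)
  ; pres = λ u v → case f u Fin.≟ f v of λ where
      (yes p) → case f-inj p of λ { refl → trans (adj-irr (complement G) (f u)) (sym (adjᵗ-irr (dual t) u)) }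
      (no ¬p) → trans (adj-complement G _ _ ¬p)
                  (trans (cong not (pres _ _)) (adj-fromDual t u v (¬p ∘ cong f))) }
  where
  open _≃_ e
  f = to ∘ fromDual t
  from∘f : ∀ u → toDual t (from (f u)) ≡ u
  from∘f u = trans (cong (toDual t) (from-to _)) (to-fromDual t u)
  f-inj : ∀ {u v} → f u ≡ f v → u ≡ v
  f-inj {u} {v} p = trans (sym (from∘f u)) (trans (cong (toDual t ∘ from) p) (from∘f v))

-- Keeps a graph expression exactly as it is listed next to a cotree of it, so that the
-- presentations yield the listed graphs by evaluation while all computation happens on the cotrees.
record Presentation : Set where
  constructor present
  field
    graph : Graph
    tree  : Cotree
    iso   : ⟪ tree ⟫ ≃ ⟨ graph ⟩
open Presentation using (graph; tree; iso)

infixr 5 _∔ᵖ_ _⊕ᵖ_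

_∔ᵖ_ _⊕ᵖ_ : Presentation → Presentation → Presentation
present G s e ∔ᵖ present H t f = present (G ∔ H) (s ∪ t) (≃-trans (Node-≃ e f) (Node≃∔ G H))
present G s e ⊕ᵖ present H t f = present (G ⊕ H) (s ⋈ t) (≃-trans (Node-≃ e f) (Node≃⊕ G H))

complementᵖ : Presentation → Presentation
complementᵖ (present G t e) = present (complement G) (dual t) (dual-≃ {G = G} e)

_∔∅ : Presentation → Presentation
present G t e ∔∅ =
  present (G ∔ edgeless 0) t (≃-trans e (≃-trans Node-empty (Node≃∔ G (edgeless 0))))

-- Since cotrees are nonempty, copies 0 is one copy, not none.
copies : ℕ → Presentation → Presentation
copies (suc (suc k)) P = P ∔ᵖ copies (suc k) P
copies _             P = P ∔∅

edgelessᵗ : ℕ → Cotree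
edgelessᵗ zero    = •
edgelessᵗ (suc m) = • ∪ edgelessᵗ m

edgeless-≃ : ∀ m → ⟪ edgelessᵗ m ⟫ ≃ ⟨ edgeless (suc m) ⟩
edgeless-≃ m = record
  { to = to m ; from = from m ; from-to = from-to m ; to-from = to-from m
  ; pres = λ u v → trans (∧-zeroʳ _) (sym (no-edge m u v)) }
  where
  to : ∀ m → Leaf (edgelessᵗ m) → Fin (suc m)
  to zero    _        = zero
  to (suc m) (inj₁ _) = zero
  to (suc m) (inj₂ u) = suc (to m u)
  from : ∀ m → Fin (suc m) → Leaf (edgelessᵗ m)
  from zero    _       = tt
  from (suc m) zero    = inj₁ tt
  from (suc m) (suc i) = inj₂ (from m i)
  from-to : ∀ m u → from m (to m u) ≡ u
  from-to zero    _        = refl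
  from-to (suc m) (inj₁ _) = refl
  from-to (suc m) (inj₂ u) = cong inj₂ (from-to m u)
  to-from : ∀ m i → to m (from m i) ≡ i
  to-from zero    zero    = refl
  to-from (suc m) zero    = refl
  to-from (suc m) (suc i) = cong suc (to-from m i)
  no-edge : ∀ m u v → adjᵗ (edgelessᵗ m) u v ≡ false
  no-edge zero    _        _        = refl
  no-edge (suc m) (inj₁ _) (inj₁ _) = refl
  no-edge (suc m) (inj₁ _) (inj₂ _) = refl
  no-edge (suc m) (inj₂ _) (inj₁ _) = refl
  no-edge (suc m) (inj₂ u) (inj₂ v) = no-edge m u v

-- Kbᵖ k presents K_{k+1,k+1}.
Kbᵖ : ℕ → Presentation
Kbᵖ k = E ⊕ᵖ E
  where E = present (edgeless (suc k)) (edgelessᵗ k) (edgeless-≃ k)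

pattern #0 = zero
pattern #1 = suc zero
pattern #2 = suc (suc zero)
pattern #3 = suc (suc (suc zero))

K₁ K₂ P₃ C₄ : Presentation
K₁ = present K1 • record
  { to = λ _ → zero ; from = λ _ → tt ; from-to = λ _ → refl
  ; to-from = λ { zero → refl } ; pres = λ _ _ → refl }
K₂ = present K2 (• ⋈ •) record
  { to = λ { (inj₁ _) → #0 ; (inj₂ _) → #1 }
  ; from = λ { #0 → inj₁ tt ; #1 → inj₂ tt }
  ; from-to = λ { (inj₁ _) → refl ; (inj₂ _) → refl }
  ; to-from = λ { #0 → refl ; #1 → refl }
  ; pres = λ { (inj₁ _) (inj₁ _) → refl ; (inj₁ _) (inj₂ _) → refl
             ; (inj₂ _) (inj₁ _) → refl ; (inj₂ _) (inj₂ _) → refl } }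
P₃ = present P3 (• ⋈ (• ∪ •)) record
  { to = to
  ; from = λ { #0 → inj₂ (inj₁ tt) ; #1 → inj₁ tt ; #2 → inj₂ (inj₂ tt) }
  ; from-to = λ { (inj₁ _) → refl ; (inj₂ (inj₁ _)) → refl ; (inj₂ (inj₂ _)) → refl }
  ; to-from = λ { #0 → refl ; #1 → refl ; #2 → refl }
  ; pres = λ { (inj₁ _) (inj₁ _) → refl ; (inj₁ _) (inj₂ (inj₁ _)) → refl
             ; (inj₁ _) (inj₂ (inj₂ _)) → refl ; (inj₂ (inj₁ _)) (inj₁ _) → refl
             ; (inj₂ (inj₁ _)) (inj₂ (inj₁ _)) → refl ; (inj₂ (inj₁ _)) (inj₂ (inj₂ _)) → refl
             ; (inj₂ (inj₂ _)) (inj₁ _) → refl ; (inj₂ (inj₂ _)) (inj₂ (inj₁ _)) → refl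
             ; (inj₂ (inj₂ _)) (inj₂ (inj₂ _)) → refl } }
  where
  to : Leaf (• ⋈ (• ∪ •)) → Fin 3
  to (inj₁ _)        = #1
  to (inj₂ (inj₁ _)) = #0
  to (inj₂ (inj₂ _)) = #2
C₄ = present C4 ((• ∪ •) ⋈ (• ∪ •)) record
  { to = to
  ; from = λ { #0 → inj₁ (inj₁ tt) ; #2 → inj₁ (inj₂ tt) ; #1 → inj₂ (inj₁ tt) ; #3 → inj₂ (inj₂ tt) }
  ; from-to = λ { (inj₁ (inj₁ _)) → refl ; (inj₁ (inj₂ _)) → refl
                ; (inj₂ (inj₁ _)) → refl ; (inj₂ (inj₂ _)) → refl }
  ; to-from = λ { #0 → refl ; #1 → refl ; #2 → refl ; #3 → refl }
  ; pres = λ { (inj₁ (inj₁ _)) (inj₁ (inj₁ _)) → refl ; (inj₁ (inj₁ _)) (inj₁ (inj₂ _)) → refl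
             ; (inj₁ (inj₁ _)) (inj₂ (inj₁ _)) → refl ; (inj₁ (inj₁ _)) (inj₂ (inj₂ _)) → refl
             ; (inj₁ (inj₂ _)) (inj₁ (inj₁ _)) → refl ; (inj₁ (inj₂ _)) (inj₁ (inj₂ _)) → refl
             ; (inj₁ (inj₂ _)) (inj₂ (inj₁ _)) → refl ; (inj₁ (inj₂ _)) (inj₂ (inj₂ _)) → refl
             ; (inj₂ (inj₁ _)) (inj₁ (inj₁ _)) → refl ; (inj₂ (inj₁ _)) (inj₁ (inj₂ _)) → refl
             ; (inj₂ (inj₁ _)) (inj₂ (inj₁ _)) → refl ; (inj₂ (inj₁ _)) (inj₂ (inj₂ _)) → refl
             ; (inj₂ (inj₂ _)) (inj₁ (inj₁ _)) → refl ; (inj₂ (inj₂ _)) (inj₁ (inj₂ _)) → refl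
             ; (inj₂ (inj₂ _)) (inj₂ (inj₁ _)) → refl ; (inj₂ (inj₂ _)) (inj₂ (inj₂ _)) → refl } }
  where
  to : Leaf ((• ∪ •) ⋈ (• ∪ •)) → Fin 4
  to (inj₁ (inj₁ _)) = #0
  to (inj₁ (inj₂ _)) = #2
  to (inj₂ (inj₁ _)) = #1
  to (inj₂ (inj₂ _)) = #3

pK₁ pK₂ : ℕ → Presentation
pK₁ p = copies p K₁
pK₂ p = copies p K₂

parts₁ block₂ parts₃ block₄ parts₅ family₅ parts₆ family₆ parts₇ : List Presentation
parts₁ = (K₁ ⊕ᵖ C₄) ∷ complementᵖ (copies 2 P₃) ∷ (K₂ ⊕ᵖ pK₂ 2) ∷ (K₁ ⊕ᵖ (K₂ ∔ᵖ P₃)) ∷ []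
block₂ = copies 2 C₄ ∷ copies 2 (K₁ ⊕ᵖ pK₂ 2) ∷ (C₄ ∔ᵖ (K₁ ⊕ᵖ pK₂ 2)) ∷ []
parts₃ = (P₃ ∔ᵖ pK₂ 2) ∷ (K₂ ∔ᵖ (K₁ ⊕ᵖ pK₂ 2)) ∷ (K₂ ∔ᵖ C₄) ∷ Kbᵖ 2
       ∷ (pK₁ 2 ⊕ᵖ (K₂ ∔ᵖ pK₁ 2)) ∷ (K₁ ⊕ᵖ (K₁ ∔ᵖ pK₂ 2)) ∷ (K₁ ⊕ᵖ C₄)
       ∷ complementᵖ (copies 2 P₃) ∷ (K₂ ⊕ᵖ pK₂ 2) ∷ (K₁ ⊕ᵖ (K₂ ∔ᵖ P₃)) ∷ []
block₄ = (pK₁ 4 ∔ᵖ (K₁ ⊕ᵖ C₄)) ∷ ((pK₁ 1 ∔ᵖ pK₂ 3) ∔ᵖ Kbᵖ 0) ∷ ((pK₁ 2 ∔ᵖ pK₂ 2) ∔ᵖ Kbᵖ 1)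
       -- For `p` equal to 4 the family contains `0 ∙ K2`, which is `edgeless 0`; hence `_∔∅`.
       ∷ ((pK₁ 3 ∔ᵖ pK₂ 1) ∔ᵖ Kbᵖ 2) ∷ ((pK₁ 4 ∔∅) ∔ᵖ Kbᵖ 3) ∷ []
parts₅ = complementᵖ (copies 2 P₃) ∷ (K₁ ⊕ᵖ (P₃ ∔ᵖ K₂)) ∷ (K₂ ⊕ᵖ pK₂ 2) ∷ (K₁ ⊕ᵖ (C₄ ∔ᵖ K₁))
       ∷ (K₁ ⊕ᵖ complementᵖ (P₃ ∔ᵖ K₂)) ∷ (complementᵖ K₂ ⊕ᵖ (P₃ ∔ᵖ K₁)) ∷ []
family₅ = ((pK₁ 1 ∔ᵖ pK₂ 2) ∔ᵖ (pK₁ 2 ⊕ᵖ (K₂ ∔ᵖ pK₁ 1)))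
        ∷ ((pK₁ 2 ∔ᵖ pK₂ 1) ∔ᵖ (pK₁ 2 ⊕ᵖ (K₂ ∔ᵖ pK₁ 2)))
        ∷ ((pK₁ 3 ∔∅) ∔ᵖ (pK₁ 2 ⊕ᵖ (K₂ ∔ᵖ pK₁ 3))) ∷ []
parts₆ = (K₁ ⊕ᵖ (C₄ ∔ᵖ pK₁ 2)) ∷ (K₁ ⊕ᵖ copies 2 P₃) ∷ (K₁ ⊕ᵖ (K₁ ∔ᵖ complementᵖ (P₃ ∔ᵖ K₂)))
       ∷ (K₁ ⊕ᵖ (K₂ ∔ᵖ complementᵖ (P₃ ∔ᵖ K₁))) ∷ (K₂ ⊕ᵖ (K₁ ∔ᵖ pK₂ 2))
       ∷ (K₁ ⊕ᵖ (K₁ ∔ᵖ (K₂ ∔ᵖ P₃))) ∷ (K₁ ⊕ᵖ (K₁ ∔ᵖ (K₁ ⊕ᵖ pK₂ 2))) ∷ []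
family₆ = ((pK₁ 1 ∔ᵖ pK₂ 1) ∔ᵖ (K₁ ⊕ᵖ (pK₂ 2 ∔ᵖ pK₁ 1)))
        ∷ ((pK₁ 2 ∔∅) ∔ᵖ (K₁ ⊕ᵖ (pK₂ 2 ∔ᵖ pK₁ 2))) ∷ []
parts₇ = (P₃ ∔ᵖ C₄) ∷ (P₃ ∔ᵖ (K₁ ⊕ᵖ pK₂ 2)) ∷ (copies 2 P₃ ∔ᵖ K₂) ∷ (K₁ ∔ᵖ pK₂ 3)
       ∷ (pK₁ 2 ∔ᵖ (K₂ ∔ᵖ C₄)) ∷ (pK₁ 3 ∔ᵖ Kbᵖ 2)
       ∷ (K₁ ∔ᵖ (K₂ ∔ᵖ (pK₁ 2 ⊕ᵖ (K₂ ∔ᵖ K₁))))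
       ∷ (pK₁ 2 ∔ᵖ (pK₁ 2 ⊕ᵖ (K₂ ∔ᵖ pK₁ 2)))
       ∷ (K₁ ∔ᵖ (K₁ ⊕ᵖ (K₁ ∔ᵖ pK₂ 2))) ∷ []

block₁ block₃ block₅ block₆ block₇ obstructions : List Presentation
block₁ = List.map (λ H → complementᵖ (P₃ ∔ᵖ H)) parts₁
block₃ = List.map (P₃ ∔ᵖ_) parts₃
block₅ = List.map (pK₁ 3 ∔ᵖ_) parts₅ ++ family₅
block₆ = List.map (pK₁ 2 ∔ᵖ_) parts₆ ++ family₆
block₇ = List.map (λ H → K₁ ∔ᵖ (K₁ ⊕ᵖ H)) parts₇
obstructions = block₁ ++ block₂ ++ block₃ ++ block₄ ++ block₅ ++ block₆ ++ block₇

graphs-obstructions : List.map graph obstructions ≡ all49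
graphs-obstructions = refl

trees : List Presentation → List Cotree
trees = List.map (sort ∘ tree)

-- The classification

-- A finite set of polar cotrees such that every cotree contains either an obstruction
-- or a member of the set with the same profile; each member is minimal for its profile.
critical : List Cotree
critical =
    •
  ∷ (• ⋈ •)
  ∷ (• ∪ •)
  ∷ (• ∪ • ⋈ •)
  ∷ (• ∪ • ∪ •)
  ∷ (• ⋈ (• ∪ •))
  ∷ (• ⋈ • ∪ • ⋈ •)
  ∷ (• ∪ • ∪ • ⋈ •)
  ∷ (• ∪ • ∪ • ∪ •)
  ∷ (• ∪ • ⋈ (• ∪ •))
  ∷ (• ⋈ (• ∪ • ⋈ •))
  ∷ ((• ∪ •) ⋈ (• ∪ •))
  ∷ (• ∪ • ⋈ • ∪ • ⋈ •)
  ∷ (• ∪ • ∪ • ∪ • ⋈ •)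
  ∷ (• ∪ (• ∪ •) ⋈ (• ∪ •))
  ∷ (• ⋈ • ∪ • ⋈ (• ∪ •))
  ∷ (• ⋈ (• ⋈ • ∪ • ⋈ •))
  ∷ ((• ∪ •) ⋈ (• ∪ • ⋈ •))
  ∷ (• ⋈ (• ∪ •) ⋈ (• ∪ •))
  ∷ (• ⋈ • ∪ • ⋈ • ∪ • ⋈ •)
  ∷ (• ∪ • ∪ • ⋈ • ∪ • ⋈ •)
  ∷ (• ∪ • ∪ (• ∪ •) ⋈ (• ∪ •))
  ∷ (• ∪ • ⋈ • ∪ • ⋈ (• ∪ •))
  ∷ (• ∪ • ⋈ (• ⋈ • ∪ • ⋈ •))
  ∷ (• ∪ (• ∪ •) ⋈ (• ∪ • ⋈ •))
  ∷ (• ⋈ • ∪ • ⋈ (• ∪ • ⋈ •))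
  ∷ (• ⋈ (• ∪ •) ∪ • ⋈ (• ∪ •))
  ∷ ((• ∪ • ∪ •) ⋈ (• ∪ • ∪ •))
  ∷ (• ⋈ • ∪ (• ∪ •) ⋈ (• ∪ •))
  ∷ ((• ∪ •) ⋈ (• ∪ • ∪ • ⋈ •))
  ∷ (• ⋈ (• ∪ • ⋈ • ∪ • ⋈ •))
  ∷ (• ∪ • ⋈ (• ∪ •) ⋈ (• ∪ •))
  ∷ (• ⋈ (• ∪ (• ∪ •) ⋈ (• ∪ •)))
  ∷ (• ⋈ (• ⋈ • ∪ • ⋈ (• ∪ •)))
  ∷ (• ⋈ • ⋈ (• ⋈ • ∪ • ⋈ •))
  ∷ (• ⋈ (• ∪ •) ⋈ (• ∪ • ⋈ •))
  ∷ ((• ∪ •) ⋈ (• ∪ • ⋈ (• ∪ •)))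
  ∷ ((• ∪ • ⋈ •) ⋈ (• ∪ • ⋈ •))
  ∷ (• ∪ (• ∪ • ∪ •) ⋈ (• ∪ • ∪ •))
  ∷ (• ∪ • ⋈ • ∪ (• ∪ •) ⋈ (• ∪ •))
  ∷ (• ∪ (• ∪ •) ⋈ (• ∪ • ∪ • ⋈ •))
  ∷ (• ⋈ • ∪ • ⋈ • ∪ • ⋈ (• ∪ •))
  ∷ (• ⋈ • ∪ • ⋈ (• ⋈ • ∪ • ⋈ •))
  ∷ (• ⋈ • ∪ (• ∪ •) ⋈ (• ∪ • ⋈ •))
  ∷ (• ∪ • ⋈ • ∪ • ⋈ • ∪ • ⋈ •)
  ∷ (• ∪ • ⋈ (• ∪ • ⋈ • ∪ • ⋈ •))
  ∷ (• ⋈ (• ∪ •) ∪ (• ∪ •) ⋈ (• ∪ •))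
  ∷ ((• ∪ •) ⋈ (• ∪ • ∪ • ∪ • ⋈ •))
  ∷ (• ∪ • ∪ • ⋈ (• ∪ •) ⋈ (• ∪ •))
  ∷ (• ∪ • ⋈ (• ∪ (• ∪ •) ⋈ (• ∪ •)))
  ∷ (• ∪ • ⋈ (• ⋈ • ∪ • ⋈ (• ∪ •)))
  ∷ (• ∪ • ⋈ • ⋈ (• ⋈ • ∪ • ⋈ •))
  ∷ (• ∪ • ⋈ (• ∪ •) ⋈ (• ∪ • ⋈ •))
  ∷ (• ∪ (• ∪ •) ⋈ (• ∪ • ⋈ (• ∪ •)))
  ∷ (• ∪ (• ∪ • ⋈ •) ⋈ (• ∪ • ⋈ •))
  ∷ (• ⋈ (• ∪ • ∪ • ⋈ • ∪ • ⋈ •))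
  ∷ (• ⋈ (• ∪ • ∪ (• ∪ •) ⋈ (• ∪ •)))
  ∷ (• ⋈ (• ∪ • ⋈ • ∪ • ⋈ (• ∪ •)))
  ∷ (• ⋈ (• ∪ • ⋈ (• ⋈ • ∪ • ⋈ •)))
  ∷ (• ⋈ (• ∪ (• ∪ •) ⋈ (• ∪ • ⋈ •)))
  ∷ (• ⋈ (• ⋈ • ∪ • ⋈ (• ∪ • ⋈ •)))
  ∷ (• ⋈ (• ⋈ (• ∪ •) ∪ • ⋈ (• ∪ •)))
  ∷ (• ⋈ • ⋈ (• ∪ • ⋈ • ∪ • ⋈ •))
  ∷ (• ∪ • ∪ (• ∪ • ∪ •) ⋈ (• ∪ • ∪ •))
  ∷ (• ∪ • ∪ • ⋈ • ∪ (• ∪ •) ⋈ (• ∪ •))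
  ∷ (• ∪ • ∪ (• ∪ •) ⋈ (• ∪ • ∪ • ⋈ •))
  ∷ (• ∪ • ⋈ • ∪ (• ∪ •) ⋈ (• ∪ • ⋈ •))
  ∷ (• ⋈ • ∪ • ⋈ (• ∪ •) ∪ • ⋈ (• ∪ •))
  ∷ (• ⋈ (• ∪ •) ∪ • ⋈ (• ⋈ • ∪ • ⋈ •))
  ∷ ((• ∪ • ∪ • ∪ •) ⋈ (• ∪ • ∪ • ∪ •))
  ∷ (• ⋈ • ∪ (• ∪ • ∪ •) ⋈ (• ∪ • ∪ •))
  ∷ (• ∪ (• ∪ •) ⋈ (• ∪ • ∪ • ∪ • ⋈ •))
  ∷ (• ⋈ • ∪ • ⋈ • ∪ (• ∪ •) ⋈ (• ∪ •))
  ∷ (• ⋈ • ∪ (• ∪ •) ⋈ (• ∪ • ∪ • ⋈ •))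
  ∷ (• ∪ • ∪ • ∪ • ⋈ (• ∪ •) ⋈ (• ∪ •))
  ∷ (• ∪ • ∪ • ⋈ (• ∪ (• ∪ •) ⋈ (• ∪ •)))
  ∷ (• ∪ • ∪ • ⋈ (• ⋈ • ∪ • ⋈ (• ∪ •)))
  ∷ (• ∪ • ∪ • ⋈ • ⋈ (• ⋈ • ∪ • ⋈ •))
  ∷ (• ∪ • ∪ • ⋈ (• ∪ •) ⋈ (• ∪ • ⋈ •))
  ∷ (• ∪ • ∪ (• ∪ •) ⋈ (• ∪ • ⋈ (• ∪ •)))
  ∷ (• ∪ • ∪ (• ∪ • ⋈ •) ⋈ (• ∪ • ⋈ •))
  ∷ (• ∪ • ⋈ (• ∪ • ∪ • ⋈ • ∪ • ⋈ •))
  ∷ (• ∪ • ⋈ (• ∪ • ∪ (• ∪ •) ⋈ (• ∪ •)))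
  ∷ (• ∪ • ⋈ (• ∪ • ⋈ • ∪ • ⋈ (• ∪ •)))
  ∷ (• ∪ • ⋈ (• ∪ • ⋈ (• ⋈ • ∪ • ⋈ •)))
  ∷ (• ∪ • ⋈ (• ∪ (• ∪ •) ⋈ (• ∪ • ⋈ •)))
  ∷ (• ∪ • ⋈ (• ⋈ • ∪ • ⋈ (• ∪ • ⋈ •)))
  ∷ (• ∪ • ⋈ (• ⋈ (• ∪ •) ∪ • ⋈ (• ∪ •)))
  ∷ (• ∪ • ⋈ • ⋈ (• ∪ • ⋈ • ∪ • ⋈ •))
  ∷ (• ⋈ • ∪ • ⋈ • ∪ • ⋈ • ∪ • ⋈ •)
  ∷ (• ⋈ • ∪ • ⋈ (• ∪ • ⋈ • ∪ • ⋈ •))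
  ∷ (• ⋈ (• ∪ • ⋈ • ∪ • ⋈ • ∪ • ⋈ •))
  ∷ (• ⋈ (• ∪ • ⋈ (• ∪ • ⋈ • ∪ • ⋈ •)))
  ∷ (• ⋈ (• ⋈ (• ∪ •) ∪ (• ∪ •) ⋈ (• ∪ •)))
  ∷ (• ∪ • ∪ • ∪ (• ∪ • ∪ •) ⋈ (• ∪ • ∪ •))
  ∷ (• ∪ (• ∪ • ∪ • ∪ •) ⋈ (• ∪ • ∪ • ∪ •))
  ∷ (• ∪ • ⋈ • ∪ (• ∪ • ∪ •) ⋈ (• ∪ • ∪ •))
  ∷ (• ∪ • ∪ (• ∪ •) ⋈ (• ∪ • ∪ • ∪ • ⋈ •))
  ∷ (• ∪ • ⋈ • ∪ • ⋈ • ∪ (• ∪ •) ⋈ (• ∪ •))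
  ∷ (• ∪ • ⋈ • ∪ (• ∪ •) ⋈ (• ∪ • ∪ • ⋈ •))
  ∷ (• ⋈ • ∪ • ⋈ • ∪ (• ∪ •) ⋈ (• ∪ • ⋈ •))
  ∷ (• ⋈ (• ∪ • ∪ • ⋈ • ∪ (• ∪ •) ⋈ (• ∪ •)))
  ∷ (• ⋈ (• ∪ • ∪ (• ∪ •) ⋈ (• ∪ • ∪ • ⋈ •)))
  ∷ (• ⋈ (• ∪ • ⋈ • ∪ (• ∪ •) ⋈ (• ∪ • ⋈ •)))
  ∷ (• ⋈ (• ⋈ • ∪ • ⋈ (• ∪ •) ∪ • ⋈ (• ∪ •)))
  ∷ (• ⋈ (• ⋈ (• ∪ •) ∪ • ⋈ (• ⋈ • ∪ • ⋈ •)))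
  ∷ (• ∪ • ∪ (• ∪ • ∪ • ∪ •) ⋈ (• ∪ • ∪ • ∪ •))
  ∷ (• ∪ • ∪ • ⋈ • ∪ (• ∪ • ∪ •) ⋈ (• ∪ • ∪ •))
  ∷ (• ⋈ (• ∪ • ∪ • ∪ (• ∪ • ∪ •) ⋈ (• ∪ • ∪ •)))
  ∷ (• ∪ • ∪ • ∪ (• ∪ • ∪ • ∪ •) ⋈ (• ∪ • ∪ • ∪ •))
  ∷ []

closedUnder : List Cotree → List Cotree → Bool
closedUnder big small =
  all (λ s → all (λ t → reduces big small (s ∪ t) ∧ reduces big small (s ⋈ t)) small) small

-- The whole case analysis of the classification, done by evaluation: the unions and joins of all
-- ordered pairs from the 110 members are shrunk and looked up.
critical-closed : closedUnder (trees obstructions) critical ≡ true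
critical-closed = refl

closed-sound : ∀ big small → closedUnder big small ≡ true → ∀ {s t} → s ∈ small → t ∈ small →
  ∀ c → T (reduces big small (node c s t))
closed-sound big small cl {s} {t} s∈ t∈ = λ { false → proj₁ entry ; true → proj₂ entry }
  where
  row   = All.lookup (all⁺ _ small (Equivalence.from T-≡ cl)) s∈
  entry = Equivalence.to T-∧ (All.lookup (all⁺ _ small row) t∈)

-- Since profiles compose, both subtrees can be replaced by embedded members of `small` with the
-- same profiles, and closure applies to the node formed from these. The lists stay variables here,
-- so the argument sees of the certificate only the equation `closedUnder big small ≡ true`.
contains : ∀ big small → closedUnder big small ≡ true → • ∈ small → ∀ t →
  (∃[ o ] o ∈ big × ⟪ o ⟫ ↪ ⟪ t ⟫) ⊎ (∃[ s ] s ∈ small × ⟪ s ⟫ ↪ ⟪ t ⟫ × prof s ≡ prof t)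
contains big small cl •∈ • = inj₂ (• , •∈ , ↪-refl , refl)
contains big small cl •∈ (node c s t) with contains big small cl •∈ s | contains big small cl •∈ t
... | inj₁ (o , o∈ , f) | _ = inj₁ (o , o∈ , ↪-trans f left)
... | inj₂ _ | inj₁ (o , o∈ , f) = inj₁ (o , o∈ , ↪-trans f right)
... | inj₂ (s′ , s′∈ , f , p) | inj₂ (t′ , t′∈ , g , q) = Sum.map
  (λ (o , o∈ , h) → o , o∈ , ↪-trans h (Node-↪ f g))
  (λ (r , r∈ , h , e) → r , r∈ , ↪-trans h (Node-↪ f g) , trans e (cong₂ (compose c) p q))
  (reduces-sound big small (node c s′ t′) (closed-sound big small cl s′∈ t′∈ c))

small? : Cotree → Bool
small? t = least (prof t) <ᵇ 4

nonpolar⇒contains : ∀ big small → closedUnder big small ≡ true → • ∈ small → all small? small ≡ true →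
  ∀ t → ¬ Polarˢ ⟪ t ⟫ → ∃[ o ] o ∈ big × ⟪ o ⟫ ↪ ⟪ t ⟫
nonpolar⇒contains big small cl •∈ sm t ¬polar with contains big small cl •∈ t
... | inj₁ o = o
... | inj₂ (s , s∈ , _ , e) = contradiction (small⇒polar t (subst (λ p → least p < 4) e
        (<ᵇ⇒< _ _ (All.lookup (all⁺ _ small (Equivalence.from T-≡ sm)) s∈)))) ¬polar

-- Minimality

-- Defined on a node and not on a cotree, because deleting the only leaf of `•` would leave no
-- cotree.
delete : ∀ c s t → Leaf (node c s t) → Cotree
delete c •              t              (inj₁ _) = t
delete c (node d s₁ s₂) t              (inj₁ w) = node c (delete d s₁ s₂ w) t
delete c s              •              (inj₂ _) = s
delete c s              (node d t₁ t₂) (inj₂ w) = node c s (delete d t₁ t₂ w)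

-- An embedding of `X` without `w`, expressed on `X` itself so that no carrier for the smaller
-- structure is needed.
record Avoids {X Y : Structure} (w : Carrier X) : Set where
  field
    map  : ∀ u → u ≢ w → Carrier Y
    inj  : ∀ {u v} (p : u ≢ w) (q : v ≢ w) → map u p ≡ map v q → u ≡ v
    pres : ∀ u v (p : u ≢ w) (q : v ≢ w) → rel Y (map u p) (map v q) ≡ rel X u v

avoids-left : ∀ {c X X′ Y w} → Avoids {X} {X′} w → Avoids {Node c X Y} {Node c X′ Y} (inj₁ w)
avoids-left r = record
  { map  = λ { (inj₁ u) p → inj₁ (map u (p ∘ cong inj₁)) ; (inj₂ u) _ → inj₂ u }
  ; inj  = λ { {inj₁ _} {inj₁ _} p q e → cong inj₁ (inj (p ∘ cong inj₁) (q ∘ cong inj₁) (inj₁-injective e))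
             ; {inj₂ _} {inj₂ _} _ _ e → cong inj₂ (inj₂-injective e) }
  ; pres = λ { (inj₁ u) (inj₁ v) _ _ → pres u v _ _ ; (inj₁ _) (inj₂ _) _ _ → refl
             ; (inj₂ _) (inj₁ _) _ _ → refl ; (inj₂ _) (inj₂ _) _ _ → refl } }
  where open Avoids r

avoids-right : ∀ {c X Y Y′ w} → Avoids {Y} {Y′} w → Avoids {Node c X Y} {Node c X Y′} (inj₂ w)
avoids-right r = record
  { map  = λ { (inj₂ u) p → inj₂ (map u (p ∘ cong inj₂)) ; (inj₁ u) _ → inj₁ u }
  ; inj  = λ { {inj₂ _} {inj₂ _} p q e → cong inj₂ (inj (p ∘ cong inj₂) (q ∘ cong inj₂) (inj₂-injective e))
             ; {inj₁ _} {inj₁ _} _ _ e → cong inj₁ (inj₁-injective e) }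
  ; pres = λ { (inj₂ u) (inj₂ v) _ _ → pres u v _ _ ; (inj₁ _) (inj₂ _) _ _ → refl
             ; (inj₂ _) (inj₁ _) _ _ → refl ; (inj₁ _) (inj₁ _) _ _ → refl } }
  where open Avoids r

delete-last : ∀ c s → Avoids {⟪ node c s • ⟫} {⟪ s ⟫} (inj₂ tt)
delete-last c s = record
  { map  = λ { (inj₂ _) p → contradiction refl p ; (inj₁ u) _ → u }
  ; inj  = λ { {inj₂ _} p _ _ → contradiction refl p ; {inj₁ _} {inj₂ _} _ q _ → contradiction refl q
             ; {inj₁ _} {inj₁ _} _ _ e → cong inj₁ e }
  ; pres = λ { (inj₂ _) _ p _ → contradiction refl p ; (inj₁ _) (inj₂ _) _ q → contradiction refl q
             ; (inj₁ _) (inj₁ _) _ _ → refl } }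

delete-avoids : ∀ c s t w → Avoids {⟪ node c s t ⟫} {⟪ delete c s t w ⟫} w
delete-avoids c • t (inj₁ _) = record
  { map  = λ { (inj₁ _) p → contradiction refl p ; (inj₂ u) _ → u }
  ; inj  = λ { {inj₁ _} p _ _ → contradiction refl p ; {inj₂ _} {inj₁ _} _ q _ → contradiction refl q
             ; {inj₂ _} {inj₂ _} _ _ e → cong inj₂ e }
  ; pres = λ { (inj₁ _) _ p _ → contradiction refl p ; (inj₂ _) (inj₁ _) _ q → contradiction refl q
             ; (inj₂ _) (inj₂ _) _ _ → refl } }
delete-avoids c (node d s₁ s₂) t (inj₁ w) = avoids-left (delete-avoids d s₁ s₂ w)
delete-avoids c •              • (inj₂ _) = delete-last c •
delete-avoids c (node d s₁ s₂) • (inj₂ _) = delete-last c (node d s₁ s₂)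
delete-avoids c •              (node d t₁ t₂) (inj₂ w) = avoids-right (delete-avoids d t₁ t₂ w)
delete-avoids c (node _ _ _)   (node d t₁ t₂) (inj₂ w) = avoids-right (delete-avoids d t₁ t₂ w)

allLeaves : ∀ t → (Leaf t → Bool) → Bool
allLeaves •            p = p tt
allLeaves (node c s t) p = allLeaves s (p ∘ inj₁) ∧ allLeaves t (p ∘ inj₂)

allLeaves-sound : ∀ t p → T (allLeaves t p) → ∀ u → T (p u)
allLeaves-sound •            p ok _        = ok
allLeaves-sound (node c s t) p ok (inj₁ u) = allLeaves-sound s _ (proj₁ (Equivalence.to T-∧ ok)) u
allLeaves-sound (node c s t) p ok (inj₂ u) =
  allLeaves-sound t _ (proj₂ (Equivalence.to (T-∧ {allLeaves s (p ∘ inj₁)}) ok)) u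

-- Deleting single leaves is a sufficient test: a proper induced subgraph misses some vertex, and
-- polarity passes to induced subgraphs.
minimal? : Cotree → Bool
minimal? •            = false
minimal? (node c s t) = not (small? (node c s t)) ∧ allLeaves (node c s t) (small? ∘ delete c s t)

minimal⇒nonpolar : ∀ t → T (minimal? t) → ¬ Polarˢ ⟪ t ⟫
minimal⇒nonpolar t@(node c s u) min polar =
  T-not-≡⇒ (proj₁ (Equivalence.to (T-∧ {not (small? t)}) min)) (<⇒<ᵇ (polar⇒small t polar))
  where
  T-not-≡⇒ : ∀ {b} → T (not b) → ¬ T b
  T-not-≡⇒ {false} _ ()

Polarˢ-avoiding : ∀ {X Y Z w} → Avoids {X} {Y} w → Polarˢ Y →
  (f : Z ↪ X) → (∀ u → _↪_.map f u ≢ w) → Polarˢ Z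
Polarˢ-avoiding r polar f miss = Polarˢ-↪ (record
  { map  = λ u → R.map (F.map u) (miss u)
  ; inj  = λ e → F.inj (R.inj _ _ e)
  ; pres = λ u v → trans (R.pres _ _ _ _) (F.pres u v) }) polar
  where
  module R = Avoids r
  module F = _↪_ f

minimal⇒polar-avoiding : ∀ t → T (minimal? t) → ∀ w {Z} (f : Z ↪ ⟪ t ⟫) → (∀ u → _↪_.map f u ≢ w) → Polarˢ Z
minimal⇒polar-avoiding t@(node c s u) min w =
  Polarˢ-avoiding (delete-avoids c s u w) (small⇒polar (delete c s u w) (<ᵇ⇒< _ _
    (allLeaves-sound t (small? ∘ delete c s u) (proj₂ (Equivalence.to (T-∧ {not (small? t)}) min)) w)))

adj-induce : ∀ G {m} (f : Fin m → V G) i j → adj (induce G f) i j ≡ adj G (f i) (f j)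
adj-induce G f i j = mask i j refl (adj-sym G (f j) (f i)) λ { refl → adj-irr G (f i) }

induce-↪ : ∀ G {m} (f : Fin m → V G) → Injective _≡_ _≡_ f → ⟨ induce G f ⟩ ↪ ⟨ G ⟩
induce-↪ G f f-inj = record { map = f ; inj = f-inj ; pres = λ i j → sym (adj-induce G f i j) }

misses⇒< : ∀ {m k} {f : Fin m → Fin k} → Injective _≡_ _≡_ f → ∀ v → (∀ i → f i ≢ v) → m < k
misses⇒< {m} {k} {f} f-inj v miss = injective⇒≤ {f = g} (λ {i} {j} → g-inj i j)
  where
  g : Fin (suc m) → Fin k
  g zero    = v
  g (suc i) = f i
  g-inj : ∀ i j → g i ≡ g j → i ≡ j
  g-inj zero    zero    _ = refl
  g-inj zero    (suc j) e = contradiction (sym e) (miss j)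
  g-inj (suc i) zero    e = contradiction e (miss i)
  g-inj (suc i) (suc j) e = cong suc (f-inj e)

hits : ∀ {m k} (f : Fin m → Fin k) → Injective _≡_ _≡_ f → ∀ v → k ≤ m → ∃[ i ] f i ≡ v
hits f f-inj v k≤m with any? (λ i → f i Fin.≟ v)
... | yes h = h
... | no ¬h = contradiction k≤m (<⇒≱ (misses⇒< f-inj v λ i e → ¬h (i , e)))

missed : ∀ {m k} (f : Fin m → Fin k) → m < k → ∃[ v ] ∀ i → f i ≢ v
missed f m<k with all? (λ v → any? (λ i → f i Fin.≟ v))
... | yes h = contradiction m<k (≤⇒≯ (injective⇒≤ {f = proj₁ ∘ h} λ {u} {v} e →
        trans (sym (proj₂ (h u))) (trans (cong f e) (proj₂ (h v)))))
... | no ¬h = let v , ¬hit = ¬∀⟶∃¬ _ _ (λ v → any? (λ i → f i Fin.≟ v)) ¬h in v , λ i e → ¬hit (i , e)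

minimal⇒CographMinObs : ∀ t G → ⟪ t ⟫ ≃ ⟨ G ⟩ → T (minimal? t) → CographMinObs ∞ (fin 3) G
minimal⇒CographMinObs t G e min = cograph , nonpolar , minimal
  where
  open _≃_ e
  G↪t : ⟨ G ⟩ ↪ ⟪ t ⟫
  G↪t = ≃⇒↪ (≃-sym e)
  cograph : Cograph G
  cograph f f-inj P4≅ = cotree-P4-free t (InducedP4-↪
    (↪-trans (≃⇒↪ (≃-sym (≅⇒≃ P4≅))) (↪-trans (induce-↪ G f f-inj) G↪t))
    (path {a = #0} {#1} {#2} {#3} refl refl refl refl refl refl))
  nonpolar : ¬ Polar ∞ (fin 3) G
  nonpolar = minimal⇒nonpolar t min ∘ Polarˢ-↪ (≃⇒↪ e)
  minimal : ∀ {m} (f : Fin m → V G) → Injective _≡_ _≡_ f → m < n G → Polar ∞ (fin 3) (induce G f)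
  minimal f f-inj m<n = let v , miss = missed f m<n in
    minimal⇒polar-avoiding t min (from v) (↪-trans (induce-↪ G f f-inj) G↪t)
      λ i p → miss i (_↪_.inj G↪t p)

-- Every minimal obstruction is one of the listed graphs

P4-rows : ∀ i j → (∀ k → adj (P 4) i k ≡ adj (P 4) j k) → i ≡ j
P4-rows = toWitness {a? = all? λ i → all? λ j → all? (λ k → adj (P 4) i k Bool.≟ adj (P 4) j k) →-dec (i Fin.≟ j)} tt

cograph⇒P4-free : ∀ G → Cograph G → ¬ InducedP4 ⟨ G ⟩
cograph⇒P4-free G cograph (path {a} {b} {c} {d} ab bc cd ac ad bd) = cograph f f-inj record
  { to = id ; from = id ; from-to = λ _ → refl ; to-from = λ _ → refl
  ; preserves = λ i j → sym (trans (adj-induce G f i j) (table i j)) }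
  where
  f : Fin 4 → V G
  f #0 = a
  f #1 = b
  f #2 = c
  f #3 = d
  rev : ∀ {u v b} → adj G u v ≡ b → adj G v u ≡ b
  rev = trans (adj-sym G _ _)
  table : ∀ i j → adj G (f i) (f j) ≡ adj (P 4) i j
  table #0 #0 = adj-irr G a
  table #0 #1 = ab
  table #0 #2 = ac
  table #0 #3 = ad
  table #1 #0 = rev ab
  table #1 #1 = adj-irr G b
  table #1 #2 = bc
  table #1 #3 = bd
  table #2 #0 = rev ac
  table #2 #1 = rev bc
  table #2 #2 = adj-irr G c
  table #2 #3 = cd
  table #3 #0 = rev ad
  table #3 #1 = rev bd
  table #3 #2 = rev cd
  table #3 #3 = adj-irr G d
  f-inj : Injective _≡_ _≡_ f
  f-inj {i} {j} e = P4-rows i j λ k → trans (sym (table i k)) (trans (cong (λ u → adj G u (f k)) e) (table j k))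

cograph⇒cotree : ∀ G → Cograph G → (V G → ⊥) ⊎ (∃[ t ] ⟪ t ⟫ ≃ ⟨ G ⟩)
cograph⇒cotree record { n = zero } _ = inj₁ λ ()
cograph⇒cotree G@record { n = suc _ ; adj = r ; adj-sym = r-sym ; adj-irr = r-irr } cograph =
  Sum.map₁ (⊥-elim ∘ cograph⇒P4-free G cograph) (cotree r r-sym r-irr)

presented-minimal : ∀ {P Ps} → all minimal? (trees Ps) ≡ true → P ∈ Ps → T (minimal? (sort (tree P)))
presented-minimal {Ps = Ps} min P∈ =
  All.lookup (all⁺ _ (trees Ps) (Equivalence.from T-≡ min)) (∈-map⁺ (sort ∘ tree) P∈)

-- The listed graph found inside `G` cannot have fewer vertices than `G`, since it would then be
-- polar by the minimality of `G`. An injection between finite sets that does not lose size is onto,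
-- which turns the embedding into an isomorphism.
classification : ∀ Ps small → closedUnder (trees Ps) small ≡ true → • ∈ small → all small? small ≡ true →
  all minimal? (trees Ps) ≡ true → ∀ G → CographMinObs ∞ (fin 3) G → ∃[ P ] P ∈ Ps × ⟨ graph P ⟩ ≃ ⟨ G ⟩
classification Ps small cl •∈ sm min G (cograph , ¬polar , minimal) with cograph⇒cotree G cograph
-- The empty graph has no cotree, but it is vacuously polar.
... | inj₁ empty = contradiction ((λ _ → true) , (λ _ → 0) , (λ _ → zero) , λ u → ⊥-elim (empty u)) ¬polar
... | inj₂ (t , e) with nonpolar⇒contains (trees Ps) small cl •∈ sm t (¬polar ∘ Polarˢ-↪ (≃⇒↪ (≃-sym e)))
... | o , o∈ , f with P , P∈ , refl ← ∈-map⁻ (sort ∘ tree) o∈ = P , P∈ , H≃G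
  where
  H = graph P
  g : ⟨ H ⟩ ↪ ⟨ G ⟩
  g = ↪-trans (≃⇒↪ (≃-sym (≃-trans (sort-≃ (tree P)) (iso P)))) (↪-trans f (≃⇒↪ e))
  open _↪_ g
  large : n G ≤ n H
  large with n G ≤? n H
  ... | yes l = l
  ... | no ¬l = contradiction
        (Polarˢ-↪ (record { map = id ; inj = id ; pres = λ i j → trans (adj-induce G map i j) (pres i j) })
                  (minimal map inj (≰⇒> ¬l)))
        (minimal⇒nonpolar (sort (tree P)) (presented-minimal min P∈) ∘ Polarˢ-↪ (≃⇒↪ (≃-trans (sort-≃ (tree P)) (iso P))))
  H≃G : ⟨ H ⟩ ≃ ⟨ G ⟩
  H≃G = record
    { to = map ; from = λ v → proj₁ (hits map inj v large)
    ; from-to = λ u → inj (proj₂ (hits map inj (map u) large))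
    ; to-from = λ v → proj₂ (hits map inj v large) ; pres = pres }

-- Components, isolated vertices and P₃-components

anyLeaf? : ∀ t {P : Leaf t → Set} → (∀ u → Dec (P u)) → Dec (∃ P)
anyLeaf? •            P? = Dec.map′ (tt ,_) proj₂ (P? tt)
anyLeaf? (node c s t) P? = Dec.map′
  [ (λ (u , p) → inj₁ u , p) , (λ (u , p) → inj₂ u , p) ]
  (λ { (inj₁ u , p) → inj₁ (u , p) ; (inj₂ u , p) → inj₂ (u , p) })
  (anyLeaf? s (P? ∘ inj₁) ⊎-dec anyLeaf? t (P? ∘ inj₂))

allLeaf? : ∀ t {P : Leaf t → Set} → (∀ u → Dec (P u)) → Dec (∀ u → P u)
allLeaf? •            P? = Dec.map′ (λ p _ → p) (λ p → p tt) (P? tt)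
allLeaf? (node c s t) P? = Dec.map′ (λ (p , q) → [ p , q ]) (λ p → p ∘ inj₁ , p ∘ inj₂)
  (allLeaf? s (P? ∘ inj₁) ×-dec allLeaf? t (P? ∘ inj₂))

leaf≟ : ∀ t (u v : Leaf t) → Dec (u ≡ v)
leaf≟ •            _ _ = yes refl
leaf≟ (node c s t) = ≡-dec (leaf≟ s) (leaf≟ t)

Isolatedˢ : Structure → Set
Isolatedˢ X = ∃[ v ] ∀ u → rel X v u ≡ false

isolated? : ∀ t → Dec (Isolatedˢ ⟪ t ⟫)
isolated? t = anyLeaf? t λ v → allLeaf? t λ u → adjᵗ t v u Bool.≟ false

Isolatedˢ-≃ : ∀ {X Y} → X ≃ Y → Isolatedˢ X → Isolatedˢ Y
Isolatedˢ-≃ {X} {Y} e (v , isolated) = to v , λ u →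
  trans (cong (rel Y (to v)) (sym (to-from u))) (trans (pres v (from u)) (isolated (from u)))
  where open _≃_ e

-- Closure under single edges replaces closure under reachability, which makes the property
-- decidable on cotrees. The edges only separate `y` from the two ends, so `x≢z` is stated.
record P3Component (X : Structure) : Set where
  constructor p3
  field
    x y z  : Carrier X
    xy     : rel X x y ≡ true
    yz     : rel X y z ≡ true
    xz     : rel X x z ≡ false
    x≢z    : x ≢ z
    closed : ∀ w → rel X x w ≡ true ⊎ rel X y w ≡ true ⊎ rel X z w ≡ true → w ≡ x ⊎ w ≡ y ⊎ w ≡ z

P3Component-≃ : ∀ {X Y} → X ≃ Y → P3Component X → P3Component Y
P3Component-≃ {X} {Y} e (p3 x y z xy yz xz x≢z closed) =
  p3 (to x) (to y) (to z) (trans (pres x y) xy) (trans (pres y z) yz) (trans (pres x z) xz)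
     (x≢z ∘ _↪_.inj (≃⇒↪ e)) λ w → Sum.map (back w) (Sum.map (back w) (back w)) ∘ closed (from w)
       ∘ Sum.map (pull w) (Sum.map (pull w) (pull w))
  where
  open _≃_ e
  pull : ∀ w {u} → rel Y (to u) w ≡ true → rel X u (from w) ≡ true
  pull w {u} p = trans (sym (pres u (from w))) (trans (cong (rel Y (to u)) (to-from w)) p)
  back : ∀ w {u} → from w ≡ u → w ≡ to u
  back w p = trans (sym (to-from w)) (cong to p)

p3Component? : ∀ t → Dec (P3Component ⟪ t ⟫)
p3Component? t = Dec.map′
  (λ { (x , y , xy , z , yz , xz , x≢z , cl) → p3 x y z xy yz xz x≢z cl })
  (λ { (p3 x y z xy yz xz x≢z cl) → x , y , xy , z , yz , xz , x≢z , cl })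
  (anyLeaf? t λ x → anyLeaf? t λ y → adj? x y ×-dec anyLeaf? t λ z →
     adj? y z ×-dec (adjᵗ t x z Bool.≟ false) ×-dec ¬? (x ≟ᴸ z) ×-dec allLeaf? t λ w →
       (adj? x w ⊎-dec adj? y w ⊎-dec adj? z w) →-dec (w ≟ᴸ x ⊎-dec w ≟ᴸ y ⊎-dec w ≟ᴸ z))
  where
  adj? : ∀ u v → Dec (adjᵗ t u v ≡ true)
  adj? u v = adjᵗ t u v Bool.≟ true
  _≟ᴸ_ = leaf≟ t

hasP3⇔ : ∀ G → HasComponentIso G P3 ⇔ P3Component ⟨ G ⟩
hasP3⇔ G = mk⇔ forth back
  where
  forth : HasComponentIso G P3 → P3Component ⟨ G ⟩
  forth (f , f-inj , closed , e) =
    p3 (g #0) (g #1) (g #2) (g-pres #0 #1) (g-pres #1 #2) (g-pres #0 #2)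
       (λ p → case trans (sym (to-from #0)) (trans (cong to (f-inj p)) (to-from #2)) of λ ())
       λ w → [ near #0 w , [ near #1 w , near #2 w ] ]
    where
    open _≅_ e
    g : Fin 3 → V G
    g = f ∘ from
    g-pres : ∀ i j → adj G (g i) (g j) ≡ adj P3 i j
    g-pres i j = trans (sym (adj-induce G f (from i) (from j)))
      (trans (sym (preserves (from i) (from j))) (cong₂ (adj P3) (to-from i) (to-from j)))
    cover : ∀ w i → g i ≡ w → w ≡ g #0 ⊎ w ≡ g #1 ⊎ w ≡ g #2
    cover w #0 p = inj₁ (sym p)
    cover w #1 p = inj₂ (inj₁ (sym p))
    cover w #2 p = inj₂ (inj₂ (sym p))
    near : ∀ i w → adj G (g i) w ≡ true → w ≡ g #0 ⊎ w ≡ g #1 ⊎ w ≡ g #2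
    near i w p = let j , q = closed (from i) w (step p here) in
      cover w (to j) (trans (cong f (from-to j)) q)
  back : P3Component ⟨ G ⟩ → HasComponentIso G P3
  back (p3 x y z xy yz xz x≢z closed) = f , (λ {i} {j} → f-inj i j) , reach , record
    { to = id ; from = id ; from-to = λ _ → refl ; to-from = λ _ → refl
    ; preserves = λ i j → sym (trans (adj-induce G f i j) (table i j)) }
    where
    f : Fin 3 → V G
    f #0 = x
    f #1 = y
    f #2 = z
    rev : ∀ {u v b} → adj G u v ≡ b → adj G v u ≡ b
    rev = trans (adj-sym G _ _)
    table : ∀ i j → adj G (f i) (f j) ≡ adj P3 i j
    table #0 #0 = adj-irr G x
    table #0 #1 = xy
    table #0 #2 = xz
    table #1 #0 = rev xy
    table #1 #1 = adj-irr G y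
    table #1 #2 = yz
    table #2 #0 = rev xz
    table #2 #1 = rev yz
    table #2 #2 = adj-irr G z
    adjacent⇒≢ : ∀ {u v} → adj G u v ≡ true → u ≢ v
    adjacent⇒≢ p refl = case trans (sym p) (adj-irr G _) of λ ()
    f-inj : ∀ i j → f i ≡ f j → i ≡ j
    f-inj #0 #0 _ = refl
    f-inj #1 #1 _ = refl
    f-inj #2 #2 _ = refl
    f-inj #0 #1 p = ⊥-elim (adjacent⇒≢ xy p)
    f-inj #1 #0 p = ⊥-elim (adjacent⇒≢ xy (sym p))
    f-inj #1 #2 p = ⊥-elim (adjacent⇒≢ yz p)
    f-inj #2 #1 p = ⊥-elim (adjacent⇒≢ yz (sym p))
    f-inj #0 #2 p = ⊥-elim (x≢z p)
    f-inj #2 #0 p = ⊥-elim (x≢z (sym p))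
    side : ∀ {w} i → adj G (f i) w ≡ true → adj G x w ≡ true ⊎ adj G y w ≡ true ⊎ adj G z w ≡ true
    side #0 p = inj₁ p
    side #1 p = inj₂ (inj₁ p)
    side #2 p = inj₂ (inj₂ p)
    near : ∀ i w → adj G (f i) w ≡ true → ∃[ j ] f j ≡ w
    near i w p = case closed w (side i p) of λ where
      (inj₁ q)        → #0 , sym q
      (inj₂ (inj₁ q)) → #1 , sym q
      (inj₂ (inj₂ q)) → #2 , sym q
    reach-from : ∀ {u v} → Reach G u v → ∃[ i ] f i ≡ u → ∃[ j ] f j ≡ v
    reach-from here hit = hit
    reach-from (step p r) (i , refl) = reach-from r (near i _ p)
    reach : ∀ i v → Reach G (f i) v → ∃[ j ] f j ≡ v
    reach i v r = reach-from r (i , refl)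

-- Counting connected components

comps : Cotree → ℕ
comps •       = 1
comps (s ∪ t) = comps s + comps t
comps (s ⋈ t) = 1

component : ∀ t → Leaf t → Fin (comps t)
component •       _ = zero
component (s ∪ t) u = join (comps s) (comps t) (Sum.map (component s) (component t) u)
component (s ⋈ t) _ = zero

component-surjective : ∀ t i → ∃[ u ] component t u ≡ i
component-surjective •       zero = tt , refl
component-surjective (s ⋈ t) zero = inj₁ (root s) , refl
component-surjective (s ∪ t) i with splitAt (comps s) i in eq
... | inj₁ j = let u , p = component-surjective s j in
      inj₁ u , trans (cong (join _ _ ∘ inj₁) p) (trans (cong (join _ _) (sym eq)) (join-splitAt (comps s) (comps t) i))
... | inj₂ j = let u , p = component-surjective t j in
      inj₂ u , trans (cong (join _ _ ∘ inj₂) p) (trans (cong (join _ _) (sym eq)) (join-splitAt (comps s) (comps t) i))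

adjacent⇒component : ∀ t u v → adjᵗ t u v ≡ true → component t u ≡ component t v
adjacent⇒component (s ∪ t) (inj₁ u) (inj₁ v) p = cong (join _ _ ∘ inj₁) (adjacent⇒component s u v p)
adjacent⇒component (s ∪ t) (inj₂ u) (inj₂ v) p = cong (join _ _ ∘ inj₂) (adjacent⇒component t u v p)
adjacent⇒component (s ⋈ t) _ _ _ = refl

component⇒reach : ∀ t G (g : Leaf t → V G) → (∀ u v → adj G (g u) (g v) ≡ adjᵗ t u v) →
  ∀ u v → component t u ≡ component t v → Reach G (g u) (g v)
component⇒reach • G g pres _ _ _ = here
component⇒reach (s ∪ t) G g pres u v p 
  with join-injective (comps s) (comps t) (Sum.map (component s) (component t) u) (Sum.map (component s) (component t) v) p
component⇒reach (s ∪ t) G g pres (inj₁ u) (inj₁ v) _ | q =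
  component⇒reach s G (g ∘ inj₁) (λ u v → pres (inj₁ u) (inj₁ v)) u v (inj₁-injective q)
component⇒reach (s ∪ t) G g pres (inj₂ u) (inj₂ v) _ | q =
  component⇒reach t G (g ∘ inj₂) (λ u v → pres (inj₂ u) (inj₂ v)) u v (inj₂-injective q)
component⇒reach (s ⋈ t) G g pres (inj₁ u) (inj₂ v) _ = step (pres _ _) here
component⇒reach (s ⋈ t) G g pres (inj₂ u) (inj₁ v) _ = step (pres _ _) here
-- Two vertices on the same side of a join are linked through any leaf of the other side.
component⇒reach (s ⋈ t) G g pres (inj₁ u) (inj₁ v) _ =
  step (pres _ (inj₂ (root t))) (step (pres _ _) here)
component⇒reach (s ⋈ t) G g pres (inj₂ u) (inj₂ v) _ =
  step (pres _ (inj₁ (root s))) (step (pres _ _) here)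

numComponents : ∀ t G → ⟪ t ⟫ ≃ ⟨ G ⟩ → NumComponents G (comps t)
numComponents t G e = component t ∘ from , surj , λ u v → mk⇔ (to-reach u v) from-reach
  where
  open _≃_ e
  surj : Surjective _≡_ _≡_ (component t ∘ from)
  surj i = let u , p = component-surjective t i in
    to u , λ { refl → trans (cong (component t) (from-to u)) p }
  to-reach : ∀ u v → component t (from u) ≡ component t (from v) → Reach G u v
  to-reach u v p = subst₂ (Reach G) (to-from u) (to-from v) (component⇒reach t G to pres _ _ p)
  from-reach : ∀ {u v} → Reach G u v → component t (from u) ≡ component t (from v)
  from-reach here = refl
  from-reach (step p r) = trans (adjacent⇒component t _ _ (trans (_≃_.pres (≃-sym e) _ _) p)) (from-reach r)

-- Representatives of distinct components in the first labelling are mutually unreachable, so the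
-- second labelling separates them. Applied both ways, this makes the number of components unique.
numComponents-≤ : ∀ {G c c′} → NumComponents G c → NumComponents G c′ → c ≤ c′
numComponents-≤ {G} {c} {c′} (f , surj , f⇔) (f′ , _ , f′⇔) = injective⇒≤ {f = f′ ∘ pick} λ {i} {j} p →
  trans (sym (pick-f i)) (trans (Equivalence.from (f⇔ _ _) (Equivalence.to (f′⇔ _ _) p)) (pick-f j))
  where
  pick : Fin c → V G
  pick i = proj₁ (surj i)
  pick-f : ∀ i → f (pick i) ≡ i
  pick-f i = proj₂ (surj i) refl

numComponents⇔ : ∀ t G → ⟪ t ⟫ ≃ ⟨ G ⟩ → ∀ c → NumComponents G c ⇔ comps t ≡ c
numComponents⇔ t G e c = mk⇔
  (λ num → ≤-antisym (numComponents-≤ (numComponents t G e) num) (numComponents-≤ num (numComponents t G e)))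
  (λ { refl → numComponents t G e })

isolated⇔ : ∀ t G → ⟪ t ⟫ ≃ ⟨ G ⟩ → HasIsolated G ⇔ Isolatedˢ ⟪ t ⟫
isolated⇔ t G e = mk⇔ (Isolatedˢ-≃ (≃-sym e)) (Isolatedˢ-≃ e)

p3Component⇔ : ∀ t G → ⟪ t ⟫ ≃ ⟨ G ⟩ → HasComponentIso G P3 ⇔ P3Component ⟪ t ⟫
p3Component⇔ t G e = mk⇔
  (P3Component-≃ (≃-sym e) ∘ Equivalence.to (hasP3⇔ G)) (Equivalence.from (hasP3⇔ G) ∘ P3Component-≃ e)

-- Reading the items of the theorem off the list

IsOneOf : Graph → List Presentation → Set
IsOneOf G = Any (λ P → G ≅ graph P)

-- `L` is a property of `G` that any cotree of `G` decides through `M`. As `G` is already known to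
-- be among `Os`, an item reduces to `sel`: filtering the sorted cotrees of `Os` by `M` leaves
-- exactly those of `Ps`, an equation between closed lists that evaluation settles.
characterise : ∀ {Os Ps} {M : Cotree → Set} (M? : ∀ t → Dec (M t)) →
  List.filter M? (trees Os) ≡ trees Ps → ∀ {L : Set} G →
  ∃[ P ] P ∈ Os × ⟨ graph P ⟩ ≃ ⟨ G ⟩ → (∀ t → ⟪ t ⟫ ≃ ⟨ G ⟩ → L ⇔ M t) →
  L ⇔ IsOneOf G Ps
characterise {Os} {Ps} {M} M? sel {L} G (P , P∈ , e) inv = mk⇔ forth back
  where
  sorted : ∀ P → ⟪ sort (tree P) ⟫ ≃ ⟨ graph P ⟩
  sorted P = ≃-trans (sort-≃ (tree P)) (iso P)
  forth : L → IsOneOf G Ps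
  forth l with ∈-map⁻ (sort ∘ tree) (subst (sort (tree P) ∈_) sel
    (∈-filter⁺ M? (∈-map⁺ (sort ∘ tree) P∈) (Equivalence.to (inv _ (≃-trans (sorted P) e)) l)))
  ... | Q , Q∈ , eq = lose Q∈ (≃⇒≅ (≃-trans (≃-sym e) (≃-trans (≃-sym (sorted P))
          (subst (λ t → ⟪ t ⟫ ≃ ⟨ graph Q ⟩) (sym eq) (sorted Q)))))
  back : IsOneOf G Ps → L
  back any with Q , Q∈ , f ← find any = Equivalence.from (inv _ (≃-trans (sorted Q) (≃-sym (≅⇒≃ f))))
    (proj₂ (∈-filter⁻ M? {xs = trees Os} (subst (sort (tree Q) ∈_) (sym sel) (∈-map⁺ (sort ∘ tree) Q∈))))

++⇔ : ∀ {A : Set} {P : A → Set} {R S : Set} (xs ys : List A) →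
  Any P xs ⇔ R → Any P ys ⇔ S → Any P (xs ++ ys) ⇔ (R ⊎ S)
++⇔ xs ys r s = mk⇔ (Sum.map (Equivalence.to r) (Equivalence.to s) ∘ ++⁻ xs)
  [ ++⁺ˡ ∘ Equivalence.from r , ++⁺ʳ xs ∘ Equivalence.from s ]

map⇔ : ∀ G (f : Presentation → Presentation) (R : Graph → Set) →
  (∀ P → (G ≅ graph (f P)) ⇔ R (graph P)) →
  ∀ Ps → IsOneOf G (List.map f Ps) ⇔ Any R (List.map graph Ps)
map⇔ G f R e Ps = mk⇔
  (map⁺ ∘ Any.map (λ {P} → Equivalence.to (e P)) ∘ map⁻)
  (map⁺ ∘ Any.map (λ {P} → Equivalence.from (e P)) ∘ map⁻)

complement-≅ : ∀ {G H} → G ≅ H → complement G ≅ complement H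
complement-≅ {G} {H} e = record
  { to = to ; from = from ; from-to = from-to ; to-from = to-from
  ; preserves = λ u v → case u Fin.≟ v of λ where
      (yes refl) → trans (adj-irr (complement H) (to u)) (sym (adj-irr (complement G) u))
      (no u≢v) → trans (adj-complement H _ _ (u≢v ∘ _↪_.inj (≃⇒↪ (≅⇒≃ e))))
                   (trans (cong not (preserves u v)) (sym (adj-complement G u v u≢v))) }
  where open _≅_ e

complement-involutive : ∀ G → complement (complement G) ≅ G
complement-involutive G = record
  { to = id ; from = id ; from-to = λ _ → refl ; to-from = λ _ → refl
  ; preserves = λ u v → case u Fin.≟ v of λ where
      (yes refl) → trans (adj-irr G u) (sym (adj-irr (complement (complement G)) u))
      (no u≢v) → sym (trans (adj-complement (complement G) u v u≢v)
                   (trans (cong not (adj-complement G u v u≢v)) (not-involutive _))) }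

≅-sym : ∀ {G H} → G ≅ H → H ≅ G
≅-sym {G} {H} e = ≃⇒≅ (≃-sym (≅⇒≃ {G} {H} e))

≅-trans : ∀ {G H K} → G ≅ H → H ≅ K → G ≅ K
≅-trans {G} {H} {K} e f = ≃⇒≅ (≃-trans (≅⇒≃ {G} {H} e) (≅⇒≃ {H} {K} f))

-- Item (1) speaks of the complement of `G`, whereas the list contains the complement of the other
-- graph.
complement-⇔ : ∀ G H → (G ≅ complement H) ⇔ (complement G ≅ H)
complement-⇔ G H = mk⇔
  (λ e → ≅-trans (complement-≅ {G} {complement H} e) (complement-involutive H))
  (λ e → ≅-trans (≅-sym (complement-involutive G)) (complement-≅ {complement G} {H} e))

-- The shift by `suc` is there because the families start at 1; for a numeral `k` the list unfolds
-- to the members written out in `all49`.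
family⇔ : ∀ fam k G → Any (G ≅_) (List.applyUpTo (fam ∘ suc) k) ⇔ (∃[ p ] (1 ≤ p × p ≤ k × G ≅ fam p))
family⇔ fam k G = mk⇔
  (λ any → let i , i<k , e = applyUpTo⁻ (fam ∘ suc) any in suc i , s≤s z≤n , i<k , e)
  (λ { (suc i , _ , i<k , e) → applyUpTo⁺ (fam ∘ suc) e i<k })

graphs⇔ : ∀ G Ps → IsOneOf G Ps ⇔ Any (G ≅_) (List.map graph Ps)
graphs⇔ G Ps = mk⇔ map⁺ map⁻

singleton⇔ : ∀ {A : Set} {P : A → Set} {x} → Any P (x ∷ []) ⇔ P x
singleton⇔ = mk⇔ (λ { (here p) → p }) here

obstruction⇔ : ∀ {Ps} → all minimal? (trees Ps) ≡ true → ∀ G →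
  (CographMinObs ∞ (fin 3) G → ∃[ P ] P ∈ Ps × ⟨ graph P ⟩ ≃ ⟨ G ⟩) →
  CographMinObs ∞ (fin 3) G ⇔ IsOneOf G Ps
obstruction⇔ {Ps} min G classify = mk⇔
  (λ obs → let P , P∈ , e = classify obs in lose P∈ (≃⇒≅ (≃-sym e)))
  (λ any → let P , P∈ , e = find any in
    minimal⇒CographMinObs (sort (tree P)) G
      (≃-trans (≃-trans (sort-≃ (tree P)) (iso P)) (≃-sym (≅⇒≃ e)))
      (presented-minimal {P} {Ps} min P∈))

obstructions-minimal : all minimal? (trees obstructions) ≡ true
obstructions-minimal = refl

found : ∀ G → CographMinObs ∞ (fin 3) G → ∃[ P ] P ∈ obstructions × ⟨ graph P ⟩ ≃ ⟨ G ⟩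
found = classification obstructions critical critical-closed (here refl) refl obstructions-minimal

theorem11 : (∀ (G : Graph) → CographMinObs ∞ (fin 3) G →
    (Connected G ⇔ Any (λ H → complement G ≅ (P3 ∔ H)) list1)
    × ((¬ Connected G × ¬ HasIsolated G × ¬ HasComponentIso G P3)
    ⇔ Any (λ H → G ≅ H) list2)
    × ((¬ Connected G × HasComponentIso G P3) ⇔ Any (λ H → G ≅ (P3 ∔ H)) list3)
    × (NumComponents G 5
    ⇔ (G ≅ ((4 ∙ K1) ∔ (K1 ⊕ C4))
    ⊎ ∃[ p ] (1 ≤ p × p ≤ 4 × G ≅ fam4 p)))
    × ((NumComponents G 4 × HasIsolated G)
    ⇔ (Any (λ H → G ≅ ((3 ∙ K1) ∔ H)) list5
    ⊎ ∃[ p ] (1 ≤ p × p ≤ 3 × G ≅ fam5 p)))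
    × ((NumComponents G 3 × HasIsolated G)
    ⇔ (Any (λ H → G ≅ ((2 ∙ K1) ∔ H)) list6
    ⊎ ∃[ p ] (1 ≤ p × p ≤ 2 × G ≅ fam6 p)))
    × ((NumComponents G 2 × HasIsolated G)
    ⇔ Any (λ H → G ≅ (K1 ∔ (K1 ⊕ H))) list7))
    × (∀ (G : Graph) → CographMinObs ∞ (fin 3) G ⇔ Any (λ H → G ≅ H) all49)
theorem11 = items , classified
  where
  isolated+ : ∀ G c t → ⟪ t ⟫ ≃ ⟨ G ⟩ → (NumComponents G c × HasIsolated G) ⇔ (comps t ≡ c × Isolatedˢ ⟪ t ⟫)
  isolated+ G c t e = numComponents⇔ t G e c ×-⇔ isolated⇔ t G e

  items : ∀ G → CographMinObs ∞ (fin 3) G → _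
  items G min =
      select block₁ (λ t → comps t ≟ 1) refl (λ t e → numComponents⇔ t G e 1)
        ⇔⨟ map⇔ G (λ H → complementᵖ (P₃ ∔ᵖ H)) (λ H → complement G ≅ (P3 ∔ H))
             (λ P → complement-⇔ G (P3 ∔ graph P)) parts₁
    , select block₂ (λ t → ¬? (comps t ≟ 1) ×-dec ¬? (isolated? t) ×-dec ¬? (p3Component? t)) refl
        (λ t e → ¬-cong-⇔ (numComponents⇔ t G e 1) ×-⇔ ¬-cong-⇔ (isolated⇔ t G e) ×-⇔ ¬-cong-⇔ (p3Component⇔ t G e))
        ⇔⨟ graphs⇔ G block₂
    , select block₃ (λ t → ¬? (comps t ≟ 1) ×-dec p3Component? t) refl
        (λ t e → ¬-cong-⇔ (numComponents⇔ t G e 1) ×-⇔ p3Component⇔ t G e)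
        ⇔⨟ map⇔ G (P₃ ∔ᵖ_) (λ H → G ≅ (P3 ∔ H)) (λ _ → mk⇔ id id) parts₃
    , select block₄ (λ t → comps t ≟ 5) refl (λ t e → numComponents⇔ t G e 5)
        ⇔⨟ graphs⇔ G block₄
        ⇔⨟ ++⇔ (((4 ∙ K1) ∔ (K1 ⊕ C4)) ∷ []) (List.applyUpTo (fam4 ∘ suc) 4) singleton⇔ (family⇔ fam4 4 G)
    , select block₅ (λ t → (comps t ≟ 4) ×-dec isolated? t) refl (isolated+ G 4)
        ⇔⨟ ++⇔ (List.map (pK₁ 3 ∔ᵖ_) parts₅) family₅
             (map⇔ G (pK₁ 3 ∔ᵖ_) (λ H → G ≅ ((3 ∙ K1) ∔ H)) (λ _ → mk⇔ id id) parts₅)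
             (graphs⇔ G family₅ ⇔⨟ family⇔ fam5 3 G)
    , select block₆ (λ t → (comps t ≟ 3) ×-dec isolated? t) refl (isolated+ G 3)
        ⇔⨟ ++⇔ (List.map (pK₁ 2 ∔ᵖ_) parts₆) family₆
             (map⇔ G (pK₁ 2 ∔ᵖ_) (λ H → G ≅ ((2 ∙ K1) ∔ H)) (λ _ → mk⇔ id id) parts₆)
             (graphs⇔ G family₆ ⇔⨟ family⇔ fam6 2 G)
    , select block₇ (λ t → (comps t ≟ 2) ×-dec isolated? t) refl (isolated+ G 2)
        ⇔⨟ map⇔ G (λ H → K₁ ∔ᵖ (K₁ ⊕ᵖ H)) (λ H → G ≅ (K1 ∔ (K1 ⊕ H))) (λ _ → mk⇔ id id) parts₇
    where
    select : ∀ Ps {L} {M : Cotree → Set} (M? : ∀ t → Dec (M t)) →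
      List.filter M? (trees obstructions) ≡ trees Ps → (∀ t → ⟪ t ⟫ ≃ ⟨ G ⟩ → L ⇔ M t) → L ⇔ IsOneOf G Ps
    select Ps M? sel = characterise {obstructions} {Ps} M? sel G (found G min)

  classified : ∀ G → CographMinObs ∞ (fin 3) G ⇔ Any (λ H → G ≅ H) all49
  classified G = obstruction⇔ obstructions-minimal G (found G)
    ⇔⨟ subst (λ Hs → IsOneOf G obstructions ⇔ Any (G ≅_) Hs) graphs-obstructions (graphs⇔ G obstructions)
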